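{- Let $n$ be a positive integer and let $A=(a_{ij})_{1\le i\le n,\,1\le j\le 2n}$ be an $n\times 2n$ matrix such that the entries $a_{ij}$ with $1\le i\le n$ and $1\le j\le 2i-1$ are generic integers, and all the remaining entries are $0$. Let $v_1,\dots,v_{2n}$ be the columns of $A$. Then the vector matroid (over $\mathbb{Q}$) of $v_1,\dots,v_{2n}$ is isomorphic to the Catalan matroid $\mathbf{C}_n$.
   Context: Generic: given real numbers $x_1,\dots,x_k$, let $x_S=\prod_{i\in S}x_i$ for each $S\subseteq[k]=\{1,\dots,k\}$ (with $x_\emptyset=1$). Form all $2^{2^k}$ possible sums of some of the $x_S$'s, i.e. the sums $\sum_{S\in\mathcal{F}}x_S$ over all families $\mathcal{F}$ of subsets of $[k]$. The collection $x_1,\dots,x_k$ is called generic if these $2^{2^k}$ sums are all distinct. "Generic integers" means that the whole collection of entries $a_{ij}$ ($1\le i\le n$, $1\le j\le 2i-1$) consists of integers and is generic. The vector matroid of an indexed family of vectors is the matroid on the index set whose independent sets are the index sets of linearly independent subfamilies. A Dyck path of length $2n$ is a path in the plane from $(0,0)$ to $(2n,0)$, with steps $(1,1)$ (up-steps) and $(1,-1)$ (down-steps), that never passes below the $x$-axis; its up-step set is the set of $i\in[2n]$ for which the $i$-th step is an up-step. The Catalan matroid $\mathbf{C}_n$ is the matroid on the ground set $[2n]$ whose bases are the up-step sets of all Dyck paths of length $2n$. -}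

module Defs where

open import Algebra.Bundles using (RawMonoid; CommutativeRing)
import Algebra.Definitions.RawMonoid as RawMonoidOps
import Algebra.Properties.Semiring.Sum as SemiringSum
open import Data.Bool.Base using (Bool; true; false; if_then_else_)
open import Data.Empty using (⊥-elim)
open import Data.Fin.Base using (Fin; zero; suc; toℕ; fromℕ)
open import Data.Fin.Permutation using (Permutation; _⟨$⟩ˡ_)
open import Data.Fin.Properties using (any?) renaming (_≟_ to _≟ᶠ_)
open import Data.Fin.Subset
open import Data.Fin.Subset.Properties
open import Data.Integer.Base as ℤ using (ℤ; +_; 0ℤ; 1ℤ; -1ℤ)
import Data.Integer.Properties as ℤₚ
open import Data.List.Base using (List; allFin; cartesianProduct; filter; map)
open import Data.Nat.Base as ℕ using (ℕ; zero; suc; z≤n; s≤s)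
import Data.Nat.Properties as ℕₚ
open import Data.Nat.Solver using () renaming (module +-*-Solver to ℕ-Solver)
open import Data.Product.Base using (Σ; ∃; ∃-syntax; _×_; _,_; proj₁; proj₂)
open import Data.Rational.Base as ℚ using (ℚ; 0ℚ; 1ℚ)
import Data.Rational.Properties as ℚₚ
open import Data.Rational.Solver using (module +-*-Solver)
open import Data.Sum.Base using (_⊎_; inj₁; inj₂)
open import Data.Vec.Base as Vec using (Vec; []; _∷_; lookup; tabulate; here; there)
import Data.Vec.Properties as Vecₚ
open import Data.Vec.Functional using (Vector)
open import Data.Unit.Base using () renaming (⊤ to Unit)
open import Function.Base using (_∘_)
open import Function.Bundles using (_⇔_; mk⇔)
open import Relation.Binary.PropositionalEquality
open import Relation.Nullary
open import Relation.Nullary.Decidable using (_×-dec_; ¬?; decidable-stable)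

private
  variable
    k l m n : ℕ

record Matroid (n : ℕ) : Set₁ where
  field
    Independent   : Subset n → Set
    ⊥-independent : Independent ⊥
    ⊆-independent : ∀ {I J} → I ⊆ J → Independent J → Independent I
    augmentation  : ∀ {I J} → Independent I → Independent J → ∣ I ∣ ℕ.< ∣ J ∣ →
                    ∃[ e ] (e ∈ J × e ∉ I × Independent (I ∪ ⁅ e ⁆))

  Basis : Subset n → Set
  Basis B = Independent B × (∀ {I} → Independent I → B ⊆ I → I ⊆ B)

image : Permutation k l → Subset k → Subset l
image φ S = tabulate (λ j → lookup S (φ ⟨$⟩ˡ j))

infix 4 _≅_

_≅_ : Matroid k → Matroid l → Set
_≅_ {k} {l} M N =
  Σ (Permutation k l) λ φ →
    ∀ S → Matroid.Independent M S ⇔ Matroid.Independent N (image φ S)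

module _ {a ℓ} (M : RawMonoid a ℓ) where
  open RawMonoid M using (Carrier; ε)

  fold∈ : Subset n → Vector Carrier n → Carrier
  fold∈ S x = RawMonoidOps.sum M (λ i → if lookup S i then x i else ε)

∏∈ : Subset n → Vector ℤ n → ℤ
∏∈ = fold∈ ℤ.*-1-rawMonoid

∑∈ : Subset n → Vector ℚ n → ℚ
∑∈ = fold∈ ℚ.+-0-rawMonoid

-- The sum of f over all 2 ^ k subsets: those without, then those with,
-- the first element.
∑-subsets : (Subset k → ℤ) → ℤ
∑-subsets {zero}  f = f []
∑-subsets {suc k} f =
  ∑-subsets (f ∘ (outside ∷_)) ℤ.+ ∑-subsets (f ∘ (inside ∷_))

-- Families of subsets are given by characteristic functions.
familySum : Vector ℤ k → (Subset k → Bool) → ℤ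
familySum x F = ∑-subsets (λ S → if F S then ∏∈ S x else 0ℤ)

Generic : Vector ℤ k → Set
Generic x = ∀ F G → familySum x F ≡ familySum x G → ∀ S → F S ≡ G S

Matrix : Set → ℕ → ℕ → Set
Matrix A m n = Vector (Vector A n) m

-- Indices in Fin start at 0, so this is j ≤ 2i − 1 for 1-based i and j.
Staircase : Fin m → Fin n → Set
Staircase i j = suc (toℕ j) ℕ.≤ 2 ℕ.* suc (toℕ i) ℕ.∸ 1

staircase? : (i : Fin m) (j : Fin n) → Dec (Staircase i j)
staircase? i j = suc (toℕ j) ℕₚ.≤? 2 ℕ.* suc (toℕ i) ℕ.∸ 1

staircasePositions : ∀ m n → List (Fin m × Fin n)
staircasePositions m n =
  filter (λ (i , j) → staircase? i j) (cartesianProduct (allFin m) (allFin n))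

staircaseEntries : Matrix ℤ m n → List ℤ
staircaseEntries {m} {n} A = map (λ (i , j) → A i j) (staircasePositions m n)

data Step : Set where
  up down : Step

rise : Step → ℤ
rise up   = 1ℤ
rise down = -1ℤ

height : Vec Step k → Fin (suc k) → ℤ
height s       zero    = 0ℤ
height (x ∷ s) (suc i) = rise x ℤ.+ height s i

IsDyckPath : Vec Step k → Set
IsDyckPath {k} s = (∀ i → 0ℤ ℤ.≤ height s i) × height s (fromℕ k) ≡ 0ℤ

isUp : Step → Side
isUp up   = inside
isUp down = outside

upSteps : Vec Step k → Subset k
upSteps = Vec.map isUp

IsUpStepSet : ∀ n → Subset (2 ℕ.* n) → Set
IsUpStepSet n S = ∃[ s ] (IsDyckPath s × upSteps s ≡ S)

-- Dyck paths by their remaining steps: Path h s says that s, started at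
-- height h, stays non-negative and ends at 0.
data Path : ℕ → Vec Step k → Set where
  end  : Path 0 []
  up   : ∀ {h} {s : Vec Step k} → Path (suc h) s → Path h (up ∷ s)
  down : ∀ {h} {s : Vec Step k} → Path h s → Path (suc h) (down ∷ s)

IsPathFrom : ℕ → Vec Step k → Set
IsPathFrom {k} h s =
  (∀ i → 0ℤ ℤ.≤ + h ℤ.+ height s i) × + h ℤ.+ height s (fromℕ k) ≡ 0ℤ

up-shift : ∀ h (s : Vec Step k) i →
           + h ℤ.+ height (up ∷ s) (suc i) ≡ + suc h ℤ.+ height s i
up-shift h s i = trans (sym (ℤₚ.+-assoc (+ h) 1ℤ (height s i)))
                       (cong (λ p → + p ℤ.+ height s i) (ℕₚ.+-comm h 1))

down-shift : ∀ h (s : Vec Step k) i →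
             + suc h ℤ.+ height (down ∷ s) (suc i) ≡ + h ℤ.+ height s i
down-shift h s i = sym (ℤₚ.+-assoc (+ suc h) -1ℤ (height s i))

path⇒isPathFrom : ∀ {h} {s : Vec Step k} → Path h s → IsPathFrom h s
path⇒isPathFrom end = (λ { zero → ℤ.+≤+ z≤n }) , refl
path⇒isPathFrom {h = h} (up {s = s} p) with path⇒isPathFrom p
... | nonneg , ends = nonneg′ , trans (up-shift h s (fromℕ _)) ends
  where
  nonneg′ : ∀ i → 0ℤ ℤ.≤ + h ℤ.+ height (up ∷ s) i
  nonneg′ zero    = ℤ.+≤+ z≤n
  nonneg′ (suc i) = subst (0ℤ ℤ.≤_) (sym (up-shift h s i)) (nonneg i)
path⇒isPathFrom (down {h = h} {s = s} p) with path⇒isPathFrom p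
... | nonneg , ends = nonneg′ , trans (down-shift h s (fromℕ _)) ends
  where
  nonneg′ : ∀ i → 0ℤ ℤ.≤ + suc h ℤ.+ height (down ∷ s) i
  nonneg′ zero    = ℤ.+≤+ z≤n
  nonneg′ (suc i) = subst (0ℤ ℤ.≤_) (sym (down-shift h s i)) (nonneg i)

isPathFrom⇒path : ∀ {h} (s : Vec Step k) → IsPathFrom h s → Path h s
isPathFrom⇒path {h = zero}  [] _ = end
isPathFrom⇒path {h = suc h} [] (_ , ())
isPathFrom⇒path {h = h} (up ∷ s) (nonneg , ends) = up (isPathFrom⇒path s
  ( (λ i → subst (0ℤ ℤ.≤_) (up-shift h s i) (nonneg (suc i)))
  , trans (sym (up-shift h s (fromℕ _))) ends))
isPathFrom⇒path {h = zero}  (down ∷ s) (nonneg , _) with nonneg (suc zero)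
... | ()
isPathFrom⇒path {h = suc h} (down ∷ s) (nonneg , ends) = down (isPathFrom⇒path s
  ( (λ i → subst (0ℤ ℤ.≤_) (down-shift h s i) (nonneg (suc i)))
  , trans (sym (down-shift h s (fromℕ _))) ends))

isDyckPath⇒path : {s : Vec Step k} → IsDyckPath s → Path 0 s
isDyckPath⇒path {s = s} (nonneg , ends) = isPathFrom⇒path s
  ( (λ i → subst (0ℤ ℤ.≤_) (sym (ℤₚ.+-identityˡ _)) (nonneg i))
  , trans (ℤₚ.+-identityˡ _) ends)

path⇒isDyckPath : {s : Vec Step k} → Path 0 s → IsDyckPath s
path⇒isDyckPath p with path⇒isPathFrom p
... | nonneg , ends =
  (λ i → subst (0ℤ ℤ.≤_) (ℤₚ.+-identityˡ _) (nonneg i)) ,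
  trans (sym (ℤₚ.+-identityˡ _)) ends

-- At most half of every final segment of the ground set lies in S; for
-- a ground set of size 2n this holds exactly when S is contained in the
-- up-step set of a Dyck path.
Sparse : Subset k → Set
Sparse []              = Unit
Sparse {suc k} (x ∷ S) = 2 ℕ.* ∣ x ∷ S ∣ ℕ.≤ suc k × Sparse S

sparse-bound : (S : Subset k) → Sparse S → 2 ℕ.* ∣ S ∣ ℕ.≤ k
sparse-bound []      _       = z≤n
sparse-bound (_ ∷ _) (b , _) = b

sparse-⊥ : ∀ k → Sparse (⊥ {k})
sparse-⊥ zero    = _
sparse-⊥ (suc k) rewrite ∣⊥∣≡0 k = z≤n , sparse-⊥ k

sparse-⊆ : {I J : Subset k} → I ⊆ J → Sparse J → Sparse I
sparse-⊆ {I = []}    {[]}    I⊆J _       = _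
sparse-⊆ {I = _ ∷ _} {_ ∷ _} I⊆J (b , s) =
  ℕₚ.≤-trans (ℕₚ.*-monoʳ-≤ 2 (p⊆q⇒∣p∣≤∣q∣ I⊆J)) b , sparse-⊆ (drop-∷-⊆ I⊆J) s

∣p∪⁅x⁆∣≤1+∣p∣ : (S : Subset k) (e : Fin k) → ∣ S ∪ ⁅ e ⁆ ∣ ℕ.≤ suc ∣ S ∣
∣p∪⁅x⁆∣≤1+∣p∣ (inside  ∷ S) zero
  rewrite ∪-identityʳ S = ℕₚ.n≤1+n _
∣p∪⁅x⁆∣≤1+∣p∣ (outside ∷ S) zero
  rewrite ∪-identityʳ S = ℕₚ.≤-refl
∣p∪⁅x⁆∣≤1+∣p∣ (inside  ∷ S) (suc e) = s≤s (∣p∪⁅x⁆∣≤1+∣p∣ S e)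
∣p∪⁅x⁆∣≤1+∣p∣ (outside ∷ S) (suc e) = ∣p∪⁅x⁆∣≤1+∣p∣ S e

sparse-augment : {I J : Subset k} → Sparse I → Sparse J → ∣ I ∣ ℕ.< ∣ J ∣ →
                 ∃[ e ] (e ∈ J × e ∉ I × Sparse (I ∪ ⁅ e ⁆))
sparse-augment {I = []} {[]} _ _ ()
sparse-augment {I = x ∷ I} {y ∷ J} (_ , sI) (bJ , sJ) I<J
  with ∣ I ∣ ℕₚ.<? ∣ J ∣
... | yes I<J′ with sparse-augment sI sJ I<J′
...   | e , e∈J , e∉I , s =
  suc e , there e∈J , e∉I ∘ drop-there ,
  ℕₚ.≤-trans (ℕₚ.*-monoʳ-≤ 2
    (ℕₚ.≤-trans (∣p∪⁅x⁆∣≤1+∣p∣ (x ∷ I) (suc e)) I<J)) bJ ,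
  s
sparse-augment {I = x ∷ I} {y ∷ J} (_ , sI) (bJ , sJ) I<J
    | no I≮J = go x y I<J bJ
  where
  J≤I = ℕₚ.≮⇒≥ I≮J

  go : ∀ x y → ∣ x ∷ I ∣ ℕ.< ∣ y ∷ J ∣ → 2 ℕ.* ∣ y ∷ J ∣ ℕ.≤ suc _ →
       ∃[ e ] (e ∈ y ∷ J × e ∉ x ∷ I × Sparse ((x ∷ I) ∪ ⁅ e ⁆))
  go inside  inside  I<J _ = ⊥-elim (I≮J (ℕ.s<s⁻¹ I<J))
  go inside  outside I<J _ = ⊥-elim (I≮J (ℕₚ.<-trans (ℕₚ.n<1+n _) I<J))
  go outside outside I<J _ = ⊥-elim (I≮J I<J)
  go outside inside  I<J b =
    zero , here , (λ ()) ,
    subst (λ S → Sparse (inside ∷ S)) (sym (∪-identityʳ I))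
          (ℕₚ.≤-trans (ℕₚ.*-monoʳ-≤ 2 I<J) b , sI)

path-upSteps : ∀ {h} {s : Vec Step k} → Path h s →
               Sparse (upSteps s) × h ℕ.+ 2 ℕ.* ∣ upSteps s ∣ ≡ k
path-upSteps end = _ , refl
path-upSteps {h = h} (up {s = s} p) with path-upSteps p
... | sp , eq = (ℕₚ.≤-trans (ℕₚ.m≤n+m _ h) (ℕₚ.≤-reflexive eq′) , sp) , eq′
  where
  eq′ = trans (ℕ-Solver.solve 2 (λ h u → h :+ con 2 :* (con 1 :+ u) :=
                                  con 1 :+ (con 1 :+ h :+ con 2 :* u))
                         refl h ∣ upSteps s ∣)
              (cong suc eq)
    where open ℕ-Solver using (_:+_; _:*_; _:=_; con)
path-upSteps (down {h = h} p) with path-upSteps p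
... | sp , eq =
  (ℕₚ.≤-trans (ℕₚ.m≤n+m _ (suc h)) (ℕₚ.≤-reflexive (cong suc eq)) , sp) ,
  cong suc eq

sparse⇒path : ∀ h d (S : Subset k) → Sparse S →
              h ℕ.+ 2 ℕ.* ∣ S ∣ ℕ.+ 2 ℕ.* d ≡ k →
              ∃[ s ] (Path h s × S ⊆ upSteps s)
sparse⇒path zero    zero    [] _ eq = [] , end , λ ()
sparse⇒path zero    (suc d) [] _ ()
sparse⇒path (suc h) d       [] _ ()
sparse⇒path h d (inside ∷ S) (_ , sp) eq with sparse⇒path (suc h) d S sp eq′
  where
  open ℕ-Solver using (_:+_; _:*_; _:=_; con)
  eq′ = ℕₚ.suc-injective (trans
    (ℕ-Solver.solve 3 (λ h u d → con 1 :+ (con 1 :+ h :+ con 2 :* u :+ con 2 :* d) :=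
                          h :+ con 2 :* (con 1 :+ u) :+ con 2 :* d)
               refl h ∣ S ∣ d) eq)
... | s , p , S⊆s = up ∷ s , up p , in⊆in S⊆s
sparse⇒path h (suc d) (outside ∷ S) (_ , sp) eq
  with sparse⇒path (suc h) d S sp eq′
  where
  open ℕ-Solver using (_:+_; _:*_; _:=_; con)
  eq′ = ℕₚ.suc-injective (trans
    (ℕ-Solver.solve 3 (λ h u d → con 1 :+ (con 1 :+ h :+ con 2 :* u :+ con 2 :* d) :=
                          h :+ con 2 :* u :+ con 2 :* (con 1 :+ d))
               refl h ∣ S ∣ d) eq)
... | s , p , S⊆s = up ∷ s , up p , out⊆ S⊆s
sparse⇒path (suc h) zero (outside ∷ S) (_ , sp) eq
  with sparse⇒path h zero S sp (ℕₚ.suc-injective eq)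
... | s , p , S⊆s = down ∷ s , down p , out⊆ S⊆s
sparse⇒path {suc k} zero zero (outside ∷ S) (_ , sp) eq =
  ⊥-elim (ℕₚ.<-irrefl refl (subst (ℕ._≤ k)
    (trans (sym (ℕₚ.+-identityʳ _)) eq) (sparse-bound S sp)))

CatalanIndependent : ∀ n → Subset (2 ℕ.* n) → Set
CatalanIndependent n S = ∃[ B ] (IsUpStepSet n B × S ⊆ B)

catalan⇒sparse : ∀ n {S} → CatalanIndependent n S → Sparse S
catalan⇒sparse _ (_ , (s , dyck , refl) , S⊆B) =
  sparse-⊆ S⊆B (proj₁ (path-upSteps (isDyckPath⇒path dyck)))

sparse⇒catalan : ∀ n {S} → Sparse S → CatalanIndependent n S
sparse⇒catalan n {S} sp
  with sparse⇒path 0 (n ℕ.∸ ∣ S ∣) S sp (begin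
    2 ℕ.* ∣ S ∣ ℕ.+ 2 ℕ.* (n ℕ.∸ ∣ S ∣)
      ≡⟨ ℕₚ.*-distribˡ-+ 2 ∣ S ∣ _ ⟨
    2 ℕ.* (∣ S ∣ ℕ.+ (n ℕ.∸ ∣ S ∣))
      ≡⟨ cong (2 ℕ.*_) (ℕₚ.m+[n∸m]≡n S≤n) ⟩
    2 ℕ.* n
      ∎)
  where
  open ≡-Reasoning
  S≤n : ∣ S ∣ ℕ.≤ n
  S≤n = ℕₚ.*-cancelˡ-≤ 2 (sparse-bound S sp)
... | s , p , S⊆s = upSteps s , (s , path⇒isDyckPath p , refl) , S⊆s

-- Its bases are exactly the up-step sets: see catalan-basis⇔.
catalanMatroid : ∀ n → Matroid (2 ℕ.* n)
catalanMatroid n = record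
  { Independent   = CatalanIndependent n
  ; ⊥-independent = sparse⇒catalan n (sparse-⊥ (2 ℕ.* n))
  ; ⊆-independent = λ I⊆J (B , isB , J⊆B) → B , isB , ⊆-trans I⊆J J⊆B
  ; augmentation  = augment
  }
  where
  augment : ∀ {I J} → CatalanIndependent n I → CatalanIndependent n J →
            ∣ I ∣ ℕ.< ∣ J ∣ →
            ∃[ e ] (e ∈ J × e ∉ I × CatalanIndependent n (I ∪ ⁅ e ⁆))
  augment indI indJ I<J
    with sparse-augment (catalan⇒sparse n indI) (catalan⇒sparse n indJ) I<J
  ... | e , e∈J , e∉I , sp = e , e∈J , e∉I , sparse⇒catalan n sp

upStepSet-size : ∀ n {B} → IsUpStepSet n B → ∣ B ∣ ≡ n
upStepSet-size _ (_ , dyck , refl) =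
  ℕₚ.*-cancelˡ-≡ _ _ 2 (proj₂ (path-upSteps (isDyckPath⇒path dyck)))

catalan-basis⇔ : ∀ n {B} →
                 Matroid.Basis (catalanMatroid n) B ⇔ IsUpStepSet n B
catalan-basis⇔ n {B} = mk⇔ to from
  where
  to : Matroid.Basis (catalanMatroid n) B → IsUpStepSet n B
  to ((U , isU , B⊆U) , maximal) =
    subst (IsUpStepSet n) (⊆-antisym (maximal (U , isU , ⊆-refl) B⊆U) B⊆U) isU

  from : IsUpStepSet n B → Matroid.Basis (catalanMatroid n) B
  from isB = (B , isB , ⊆-refl) , maximal
    where
    maximal : ∀ {I} → CatalanIndependent n I → B ⊆ I → I ⊆ B
    maximal (U , isU , I⊆U) B⊆I {x} x∈I with x ∈? B
    ... | yes x∈B = x∈B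
    ... | no  x∉B = ⊥-elim (ℕₚ.<-irrefl
      (trans (upStepSet-size n isB) (sym (upStepSet-size n isU)))
      (p⊂q⇒∣p∣<∣q∣ (⊆-trans B⊆I I⊆U , x , I⊆U x∈I , x∉B)))

LinearlyIndependent : Vector (Vector ℚ m) k → Subset k → Set
LinearlyIndependent {k = k} v S =
  ∀ (c : Vector ℚ k) → (∀ i → ∑∈ S (λ j → c j ℚ.* v j i) ≡ 0ℚ) →
  ∀ j → j ∈ S → c j ≡ 0ℚ

columns : Matrix ℤ m n → Vector (Vector ℚ m) n
columns A j i = A i j ℚ./ 1

open SemiringSum (CommutativeRing.semiring ℚₚ.+-*-commutativeRing)
  using (sum; sum-cong-≗; sum-replicate-zero; ∑-distrib-+; ∑-comm;
         *-distribˡ-sum; *-distribʳ-sum)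

sum-zero : (f : Vector ℚ k) → (∀ j → f j ≡ 0ℚ) → sum f ≡ 0ℚ
sum-zero {k} f f≡0 = trans (sum-cong-≗ f≡0) (sum-replicate-zero k)

∉-or-∈ : (S : Subset k) {P : Fin k → Set} →
         (∀ j → j ∈ S → P j) → (∀ j → j ∉ S → P j) → ∀ j → P j
∉-or-∈ S inS outS j with j ∈? S
... | yes j∈S = inS j j∈S
... | no  j∉S = outS j j∉S

Supported : Subset k → Vector ℚ k → Set
Supported S c = ∀ j → j ∉ S → c j ≡ 0ℚ

restrict : Subset k → Vector ℚ k → Vector ℚ k
restrict S c j = if lookup S j then c j else 0ℚ

restrict-∈ : ∀ (S : Subset k) (c : Vector ℚ k) j → j ∈ S → restrict S c j ≡ c j
restrict-∈ S c j j∈S rewrite Vecₚ.[]=⇒lookup j∈S = refl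

restrict-supported : (S : Subset k) (c : Vector ℚ k) → Supported S (restrict S c)
restrict-supported S c j j∉S with lookup S j in eq
... | inside  = ⊥-elim (j∉S (Vecₚ.lookup⇒[]= j S eq))
... | outside = refl

∑∈-restrict : ∀ (S : Subset k) (c w : Vector ℚ k) →
  ∑∈ S (λ j → c j ℚ.* w j) ≡ sum (λ j → restrict S c j ℚ.* w j)
∑∈-restrict S c w = sum-cong-≗ pointwise
  where
  pointwise : ∀ j → (if lookup S j then c j ℚ.* w j else 0ℚ) ≡
                    restrict S c j ℚ.* w j
  pointwise j with lookup S j
  ... | inside  = refl
  ... | outside = sym (ℚₚ.*-zeroˡ (w j))

∑∈-supported : ∀ (S : Subset k) (c w : Vector ℚ k) → Supported S c →
  ∑∈ S (λ j → c j ℚ.* w j) ≡ sum (λ j → c j ℚ.* w j)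
∑∈-supported S c w supp = trans (∑∈-restrict S c w) (sum-cong-≗ (λ j →
  cong (ℚ._* w j) (∉-or-∈ S (restrict-∈ S c)
    (λ j j∉S → trans (restrict-supported S c j j∉S) (sym (supp j j∉S))) j)))

δ : Fin k → Fin k → ℚ
δ zero    zero    = 1ℚ
δ zero    (suc j) = 0ℚ
δ (suc p) zero    = 0ℚ
δ (suc p) (suc j) = δ p j

δ-same : (p : Fin k) → δ p p ≡ 1ℚ
δ-same zero    = refl
δ-same (suc p) = δ-same p

δ-other : (p j : Fin k) → j ≢ p → δ p j ≡ 0ℚ
δ-other zero    zero    j≢p = ⊥-elim (j≢p refl)
δ-other zero    (suc j) j≢p = refl
δ-other (suc p) zero    j≢p = refl
δ-other (suc p) (suc j) j≢p = δ-other p j (j≢p ∘ cong suc)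

sum-δ : ∀ (p : Fin k) (f : Vector ℚ k) → sum (λ j → δ p j ℚ.* f j) ≡ f p
sum-δ zero f = trans
  (cong₂ ℚ._+_ (ℚₚ.*-identityˡ (f zero)) (sum-zero _ (λ j → ℚₚ.*-zeroˡ (f (suc j)))))
  (ℚₚ.+-identityʳ (f zero))
sum-δ (suc p) f = trans
  (cong₂ ℚ._+_ (ℚₚ.*-zeroˡ (f zero)) (sum-δ p (f ∘ suc)))
  (ℚₚ.+-identityˡ (f (suc p)))

shift : Fin k → ℚ → Vector ℚ k → Vector ℚ k
shift p t c j = c j ℚ.+ t ℚ.* δ p j

shift-same : ∀ (p : Fin k) t c → shift p t c p ≡ c p ℚ.+ t
shift-same p t c = cong (c p ℚ.+_)
  (trans (cong (t ℚ.*_) (δ-same p)) (ℚₚ.*-identityʳ t))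

shift-other : ∀ (p : Fin k) t c j → j ≢ p → shift p t c j ≡ c j
shift-other p t c j j≢p = trans
  (cong (c j ℚ.+_) (trans (cong (t ℚ.*_) (δ-other p j j≢p)) (ℚₚ.*-zeroʳ t)))
  (ℚₚ.+-identityʳ (c j))

sum-shift : ∀ (p : Fin k) t c f →
  sum (λ j → shift p t c j ℚ.* f j) ≡ sum (λ j → c j ℚ.* f j) ℚ.+ t ℚ.* f p
sum-shift p t c f = begin
  sum (λ j → shift p t c j ℚ.* f j)
    ≡⟨ sum-cong-≗ (λ j → solve 4 (λ c t d f →
         (c :+ t :* d) :* f := c :* f :+ t :* (d :* f)) refl (c j) t (δ p j) (f j)) ⟩
  sum (λ j → c j ℚ.* f j ℚ.+ t ℚ.* (δ p j ℚ.* f j))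
    ≡⟨ ∑-distrib-+ (λ j → c j ℚ.* f j) (λ j → t ℚ.* (δ p j ℚ.* f j)) ⟩
  sum (λ j → c j ℚ.* f j) ℚ.+ sum (λ j → t ℚ.* (δ p j ℚ.* f j))
    ≡⟨ cong (sum (λ j → c j ℚ.* f j) ℚ.+_)
         (trans (sym (*-distribˡ-sum t (λ j → δ p j ℚ.* f j)))
                (cong (t ℚ.*_) (sum-δ p f))) ⟩
  sum (λ j → c j ℚ.* f j) ℚ.+ t ℚ.* f p
    ∎
  where
  open ≡-Reasoning
  open +-*-Solver

sum-eliminate : ∀ (c f g : Vector ℚ k) q r →
  sum (λ j → c j ℚ.* (f j ℚ.- g j ℚ.* q ℚ.* r)) ≡
  sum (λ j → c j ℚ.* f j) ℚ.- q ℚ.* r ℚ.* sum (λ j → c j ℚ.* g j)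
sum-eliminate c f g q r = begin
  sum (λ j → c j ℚ.* (f j ℚ.- g j ℚ.* q ℚ.* r))
    ≡⟨ sum-cong-≗ (λ j → solve 5 (λ c f g q r →
         c :* (f :- g :* q :* r) := c :* f :+ :- (q :* r) :* (c :* g))
         refl (c j) (f j) (g j) q r) ⟩
  sum (λ j → c j ℚ.* f j ℚ.+ ℚ.- (q ℚ.* r) ℚ.* (c j ℚ.* g j))
    ≡⟨ ∑-distrib-+ (λ j → c j ℚ.* f j) (λ j → ℚ.- (q ℚ.* r) ℚ.* (c j ℚ.* g j)) ⟩
  sum (λ j → c j ℚ.* f j) ℚ.+ sum (λ j → ℚ.- (q ℚ.* r) ℚ.* (c j ℚ.* g j))
    ≡⟨ cong (sum (λ j → c j ℚ.* f j) ℚ.+_)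
         (sym (*-distribˡ-sum (ℚ.- (q ℚ.* r)) (λ j → c j ℚ.* g j))) ⟩
  sum (λ j → c j ℚ.* f j) ℚ.+ ℚ.- (q ℚ.* r) ℚ.* sum (λ j → c j ℚ.* g j)
    ≡⟨ solve 3 (λ s u t → s :+ :- u :* t := s :- u :* t)
         refl (sum (λ j → c j ℚ.* f j)) (q ℚ.* r) (sum (λ j → c j ℚ.* g j)) ⟩
  sum (λ j → c j ℚ.* f j) ℚ.- q ℚ.* r ℚ.* sum (λ j → c j ℚ.* g j)
    ∎
  where
  open ≡-Reasoning
  open +-*-Solver

reciprocal : ∀ x → x ≢ 0ℚ → ∃[ y ] x ℚ.* y ≡ 1ℚ
reciprocal x x≢0 = ℚ.1/ x , ℚₚ.*-inverseʳ x
  where instance _ = ℚ.≢-nonZero x≢0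

*-zero-cancelʳ : ∀ x y → y ≢ 0ℚ → x ℚ.* y ≡ 0ℚ → x ≡ 0ℚ
*-zero-cancelʳ x y y≢0 xy≡0 with reciprocal y y≢0
... | z , yz≡1 = begin
  x                ≡⟨ ℚₚ.*-identityʳ x ⟨
  x ℚ.* 1ℚ         ≡⟨ cong (x ℚ.*_) yz≡1 ⟨
  x ℚ.* (y ℚ.* z)  ≡⟨ ℚₚ.*-assoc x y z ⟨
  x ℚ.* y ℚ.* z    ≡⟨ cong (ℚ._* z) xy≡0 ⟩
  0ℚ ℚ.* z         ≡⟨ ℚₚ.*-zeroˡ z ⟩
  0ℚ               ∎
  where open ≡-Reasoning

-- Dependent R J a and Free R J a concern the vectors a j, j ∈ J, with
-- only their coordinates i ∈ R taken into account.
Dependent : Subset n → Subset k → Vector (Vector ℚ n) k → Set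
Dependent R J a =
  ∃[ c ] (Supported J c × (∃[ j ] (j ∈ J × c j ≢ 0ℚ)) ×
          (∀ i → i ∈ R → sum (λ j → c j ℚ.* a j i) ≡ 0ℚ))

Free : Subset n → Subset k → Vector (Vector ℚ n) k → Set
Free R J a =
  ∀ c → Supported J c → (∀ i → i ∈ R → sum (λ j → c j ℚ.* a j i) ≡ 0ℚ) →
  ∀ j → c j ≡ 0ℚ

-- S - p is less convenient here: the local function in the definition of
-- _─_ takes both sets as parameters, so it does not reduce to a tail.
infixl 5 _∖_

_∖_ : Subset k → Fin k → Subset k
S ∖ p = S ∩ ∁ ⁅ p ⁆

∖-⊆ : ∀ (S : Subset k) p → S ∖ p ⊆ S
∖-⊆ S p = p∩q⊆p S (∁ ⁅ p ⁆)

∖-∈ : ∀ (S : Subset k) {p j} → j ∈ S → j ≢ p → j ∈ S ∖ p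
∖-∈ S j∈S j≢p = x∈p∩q⁺ (j∈S , x∉p⇒x∈∁p (x≢y⇒x∉⁅y⁆ j≢p))

∖-∉ : ∀ (S : Subset k) p → p ∉ S ∖ p
∖-∉ S p p∈ = x∈∁p⇒x∉p (proj₂ (x∈p∩q⁻ S (∁ ⁅ p ⁆) p∈)) (x∈⁅x⁆ p)

∣∖∣ : ∀ (S : Subset k) p → ∣ S ∣ ℕ.≤ suc ∣ S ∖ p ∣
∣∖∣ S p = ℕₚ.≤-trans (p⊆q⇒∣p∣≤∣q∣ S⊆) (∣p∪⁅x⁆∣≤1+∣p∣ (S ∖ p) p)
  where
  S⊆ : S ⊆ (S ∖ p) ∪ ⁅ p ⁆
  S⊆ {j} j∈S with j ≟ᶠ p
  ... | yes refl = q⊆p∪q (S ∖ p) ⁅ p ⁆ (x∈⁅x⁆ p)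
  ... | no  j≢p  = p⊆p∪q ⁅ p ⁆ (∖-∈ S j∈S j≢p)

zero-row : (J : Subset k) (a : Vector (Vector ℚ (suc n)) k) →
           ¬ (∃[ j ] (j ∈ J × a j zero ≢ 0ℚ)) →
           ∀ c → Supported J c → sum (λ j → c j ℚ.* a j zero) ≡ 0ℚ
zero-row J a noPivot c supp = sum-zero _ (∉-or-∈ J
  (λ j j∈J → trans (cong (c j ℚ.*_) (decidable-stable (a j zero ℚₚ.≟ 0ℚ)
                     (λ a≢0 → noPivot (j , j∈J , a≢0))))
                   (ℚₚ.*-zeroʳ (c j)))
  (λ j j∉J → trans (cong (ℚ._* a j zero) (supp j j∉J))
                   (ℚₚ.*-zeroˡ (a j zero))))

x-1*x : ∀ x → x ℚ.- 1ℚ ℚ.* x ≡ 0ℚ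
x-1*x x = trans (cong (λ y → x ℚ.- y) (ℚₚ.*-identityˡ x)) (ℚₚ.+-inverseʳ x)

module Pivot {n k} (R : Subset n) (J : Subset k) (a : Vector (Vector ℚ (suc n)) k)
             (p : Fin k) (p∈J : p ∈ J) (pivot≢0 : a p zero ≢ 0ℚ)
             (q : ℚ) (pivot*q≡1 : a p zero ℚ.* q ≡ 1ℚ) where

  open ≡-Reasoning
  open +-*-Solver

  a′ : Vector (Vector ℚ n) k
  a′ j i = a j (suc i) ℚ.- a j zero ℚ.* q ℚ.* a p (suc i)

  S₀ : Vector ℚ k → ℚ
  S₀ c = sum (λ j → c j ℚ.* a j zero)

  S : Vector ℚ k → Fin n → ℚ
  S c i = sum (λ j → c j ℚ.* a j (suc i))

  S′ : Vector ℚ k → Fin n → ℚ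
  S′ c i = sum (λ j → c j ℚ.* a′ j i)

  S′≡ : ∀ c i → S′ c i ≡ S c i ℚ.- q ℚ.* a p (suc i) ℚ.* S₀ c
  S′≡ c i = sum-eliminate c (λ j → a j (suc i)) (λ j → a j zero) q (a p (suc i))

  a′p≡0 : ∀ i → a′ p i ≡ 0ℚ
  a′p≡0 i = begin
    a p (suc i) ℚ.- a p zero ℚ.* q ℚ.* a p (suc i)
      ≡⟨ cong (λ t → a p (suc i) ℚ.- t ℚ.* a p (suc i)) pivot*q≡1 ⟩
    a p (suc i) ℚ.- 1ℚ ℚ.* a p (suc i)
      ≡⟨ x-1*x (a p (suc i)) ⟩
    0ℚ
      ∎

  dependent : Dependent R (J ∖ p) a′ → Dependent (inside ∷ R) J a
  dependent (c , supp , (j , j∈J∖p , cj≢0) , rel) =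
    c′ , supp′ , (j , ∖-⊆ J p j∈J∖p , c′j≢0) , rel′
    where
    t = ℚ.- (q ℚ.* S₀ c)

    c′ : Vector ℚ k
    c′ = shift p t c

    supp′ : Supported J c′
    supp′ j j∉J = trans (shift-other p t c j (λ { refl → j∉J p∈J }))
                        (supp j (j∉J ∘ ∖-⊆ J p))

    c′j≢0 : c′ j ≢ 0ℚ
    c′j≢0 c′j≡0 = cj≢0 (trans
      (sym (shift-other p t c j (λ { refl → ∖-∉ J p j∈J∖p }))) c′j≡0)

    rel′ : ∀ i → i ∈ inside ∷ R → sum (λ j → c′ j ℚ.* a j i) ≡ 0ℚ
    rel′ zero _ = begin
      S₀ c′
        ≡⟨ sum-shift p t c (λ j → a j zero) ⟩
      S₀ c ℚ.+ ℚ.- (q ℚ.* S₀ c) ℚ.* a p zero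
        ≡⟨ solve 3 (λ s q a → s :+ :- (q :* s) :* a := s :- a :* q :* s)
             refl (S₀ c) q (a p zero) ⟩
      S₀ c ℚ.- a p zero ℚ.* q ℚ.* S₀ c
        ≡⟨ cong (λ u → S₀ c ℚ.- u ℚ.* S₀ c) pivot*q≡1 ⟩
      S₀ c ℚ.- 1ℚ ℚ.* S₀ c
        ≡⟨ x-1*x (S₀ c) ⟩
      0ℚ
        ∎
    rel′ (suc i) (there i∈R) = begin
      S c′ i
        ≡⟨ sum-shift p t c (λ j → a j (suc i)) ⟩
      S c i ℚ.+ ℚ.- (q ℚ.* S₀ c) ℚ.* a p (suc i)
        ≡⟨ solve 4 (λ s q s₀ a → s :+ :- (q :* s₀) :* a := s :- q :* a :* s₀)
             refl (S c i) q (S₀ c) (a p (suc i)) ⟩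
      S c i ℚ.- q ℚ.* a p (suc i) ℚ.* S₀ c
        ≡⟨ S′≡ c i ⟨
      S′ c i
        ≡⟨ rel i i∈R ⟩
      0ℚ
        ∎

  free : Free R (J ∖ p) a′ → Free (inside ∷ R) J a
  free free-a′ c supp rel = c≡0
    where
    t = ℚ.- c p

    c′ : Vector ℚ k
    c′ = shift p t c

    supp′ : Supported (J ∖ p) c′
    supp′ j j∉J∖p with j ≟ᶠ p
    ... | yes refl = trans (shift-same p t c) (ℚₚ.+-inverseʳ (c p))
    ... | no  j≢p  = trans (shift-other p t c j j≢p)
      (supp j (λ j∈J → j∉J∖p (∖-∈ J j∈J j≢p)))

    rel′ : ∀ i → i ∈ R → S′ c′ i ≡ 0ℚ
    rel′ i i∈R = begin
      S′ c′ i
        ≡⟨ sum-shift p t c (λ j → a′ j i) ⟩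
      S′ c i ℚ.+ t ℚ.* a′ p i
        ≡⟨ cong₂ (λ x y → x ℚ.+ t ℚ.* y) (S′≡ c i) (a′p≡0 i) ⟩
      S c i ℚ.- q ℚ.* a p (suc i) ℚ.* S₀ c ℚ.+ t ℚ.* 0ℚ
        ≡⟨ cong₂ (λ x y → x ℚ.- q ℚ.* a p (suc i) ℚ.* y ℚ.+ t ℚ.* 0ℚ)
             (rel (suc i) (there i∈R)) (rel zero here) ⟩
      0ℚ ℚ.- q ℚ.* a p (suc i) ℚ.* 0ℚ ℚ.+ t ℚ.* 0ℚ
        ≡⟨ cong₂ (λ x y → 0ℚ ℚ.- x ℚ.+ y)
             (ℚₚ.*-zeroʳ (q ℚ.* a p (suc i))) (ℚₚ.*-zeroʳ t) ⟩
      0ℚ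
        ∎

    others : ∀ j → j ≢ p → c j ≡ 0ℚ
    others j j≢p = trans (sym (shift-other p t c j j≢p)) (free-a′ c′ supp′ rel′ j)

    cp≡0 : c p ≡ 0ℚ
    cp≡0 = *-zero-cancelʳ (c p) (a p zero) pivot≢0 (begin
      c p ℚ.* a p zero
        ≡⟨ sum-δ p (λ j → c j ℚ.* a j zero) ⟨
      sum (λ j → δ p j ℚ.* (c j ℚ.* a j zero))
        ≡⟨ sum-cong-≗ pointwise ⟩
      S₀ c
        ≡⟨ rel zero here ⟩
      0ℚ
        ∎)
      where
      pointwise : ∀ j → δ p j ℚ.* (c j ℚ.* a j zero) ≡ c j ℚ.* a j zero
      pointwise j with j ≟ᶠ p
      ... | yes refl = trans (cong (ℚ._* (c p ℚ.* a p zero)) (δ-same p))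
                             (ℚₚ.*-identityˡ (c p ℚ.* a p zero))
      ... | no  j≢p  =
        trans (cong (δ p j ℚ.*_) cjaj≡0) (trans (ℚₚ.*-zeroʳ (δ p j)) (sym cjaj≡0))
        where
        cjaj≡0 : c j ℚ.* a j zero ≡ 0ℚ
        cjaj≡0 = trans (cong (ℚ._* a j zero) (others j j≢p)) (ℚₚ.*-zeroˡ (a j zero))

    c≡0 : ∀ j → c j ≡ 0ℚ
    c≡0 j with j ≟ᶠ p
    ... | yes refl = cp≡0
    ... | no  j≢p  = others j j≢p

eliminate : (R : Subset n) (J : Subset k) (a : Vector (Vector ℚ n) k) →
            Dependent R J a ⊎ (Free R J a × ∣ J ∣ ℕ.≤ ∣ R ∣)
eliminate {k = k} [] J a with nonempty? J
... | yes (p , p∈J) = inj₁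
  ( δ p
  , (λ j j∉J → δ-other p j (λ { refl → j∉J p∈J }))
  , (p , p∈J , λ δ≡0 → ℚₚ.1≢0 (trans (sym (δ-same p)) δ≡0))
  , λ ())
... | no empty = inj₂
  ( (λ c supp _ j → supp j (λ j∈J → empty (j , j∈J)))
  , ℕₚ.≤-reflexive (trans (cong ∣_∣ (Empty-unique empty)) (∣⊥∣≡0 k)))
eliminate (outside ∷ R) J a with eliminate R J (λ j i → a j (suc i))
... | inj₁ (c , supp , nonzero , rel) =
  inj₁ (c , supp , nonzero , λ { (suc i) (there i∈R) → rel i i∈R })
... | inj₂ (free , J≤R) =
  inj₂ ((λ c supp rel → free c supp (λ i i∈R → rel (suc i) (there i∈R))) , J≤R)
eliminate (inside ∷ R) J a
  with any? (λ j → (j ∈? J) ×-dec ¬? (a j zero ℚₚ.≟ 0ℚ))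
... | no noPivot
  with row₀ ← zero-row J a noPivot | eliminate R J (λ j i → a j (suc i))
...   | inj₁ (c , supp , nonzero , rel) = inj₁
  ( c , supp , nonzero
  , λ { zero _ → row₀ c supp ; (suc i) (there i∈R) → rel i i∈R })
...   | inj₂ (free , J≤R) = inj₂
  ( (λ c supp rel → free c supp (λ i i∈R → rel (suc i) (there i∈R)))
  , ℕₚ.m≤n⇒m≤1+n J≤R)
eliminate (inside ∷ R) J a | yes (p , p∈J , pivot≢0) with reciprocal (a p zero) pivot≢0
... | q , pivot*q≡1
  with eliminate R (J ∖ p) (Pivot.a′ R J a p p∈J pivot≢0 q pivot*q≡1)
...   | inj₁ dep = inj₁ (Pivot.dependent R J a p p∈J pivot≢0 q pivot*q≡1 dep)
...   | inj₂ (free , J∖p≤R) = inj₂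
  ( Pivot.free R J a p p∈J pivot≢0 q pivot*q≡1 free
  , ℕₚ.≤-trans (∣∖∣ J p) (s≤s J∖p≤R))

dependent⇒¬free : {R : Subset n} {J : Subset k} {a : Vector (Vector ℚ n) k} →
                  Dependent R J a → ¬ Free R J a
dependent⇒¬free (c , supp , (j , _ , cj≢0) , rel) free = cj≢0 (free c supp rel j)

free⇒linearlyIndependent : (v : Vector (Vector ℚ m) k) (S : Subset k) →
                           Free ⊤ S v → LinearlyIndependent v S
free⇒linearlyIndependent v S free c rel j j∈S = trans
  (sym (restrict-∈ S c j j∈S))
  (free (restrict S c) (restrict-supported S c)
    (λ i _ → trans (sym (∑∈-restrict S c (λ j → v j i))) (rel i)) j)

linearlyIndependent⇒free : (v : Vector (Vector ℚ m) k) (S : Subset k) →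
                           LinearlyIndependent v S → Free ⊤ S v
linearlyIndependent⇒free v S ind c supp rel = ∉-or-∈ S
  (ind c (λ i → trans (∑∈-supported S c (λ j → v j i) supp) (rel i ∈⊤)))
  supp

linearlyIndependent? : (v : Vector (Vector ℚ m) k) (S : Subset k) →
                       Dec (LinearlyIndependent v S)
linearlyIndependent? v S with eliminate ⊤ S v
... | inj₁ dep        = no (dependent⇒¬free dep ∘ linearlyIndependent⇒free v S)
... | inj₂ (free , _) = yes (free⇒linearlyIndependent v S free)

¬linearlyIndependent⇒dependent : (v : Vector (Vector ℚ m) k) (S : Subset k) →
                                 ¬ LinearlyIndependent v S → Dependent ⊤ S v
¬linearlyIndependent⇒dependent v S ¬ind with eliminate ⊤ S v
... | inj₁ dep        = dep
... | inj₂ (free , _) = ⊥-elim (¬ind (free⇒linearlyIndependent v S free))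

InSpan : Vector (Vector ℚ m) k → Subset k → Vector ℚ m → Set
InSpan v I w =
  ∃[ b ] (Supported I b × (∀ i → w i ≡ sum (λ j → b j ℚ.* v j i)))

∈⇒inSpan : ∀ (v : Vector (Vector ℚ m) k) I e → e ∈ I → InSpan v I (v e)
∈⇒inSpan v I e e∈I =
  δ e ,
  (λ j j∉I → δ-other e j (λ { refl → j∉I e∈I })) ,
  (λ i → sym (sum-δ e (λ j → v j i)))

dependent⇒inSpan : ∀ (v : Vector (Vector ℚ m) k) I e → Free ⊤ I v →
                   Dependent ⊤ (I ∪ ⁅ e ⁆) v → InSpan v I (v e)
dependent⇒inSpan {k = k} v I e free (c , supp , (j , _ , cj≢0) , rel)
  with reciprocal (c e) ce≢0
  where
  ce≢0 : c e ≢ 0ℚ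
  ce≢0 ce≡0 = cj≢0 (free c supp′ rel j)
    where
    supp′ : Supported I c
    supp′ j j∉I with j ≟ᶠ e
    ... | yes refl = ce≡0
    ... | no  j≢e  = supp j λ j∈ → case-∪ (x∈p∪q⁻ I ⁅ e ⁆ j∈)
      where
      case-∪ : ¬ (j ∈ I ⊎ j ∈ ⁅ e ⁆)
      case-∪ (inj₁ j∈I) = j∉I j∈I
      case-∪ (inj₂ j∈e) = j≢e (x∈⁅y⁆⇒x≡y e j∈e)
... | y , ce*y≡1 = b , supp-b , spans
  where
  open ≡-Reasoning
  open +-*-Solver

  c′ b : Vector ℚ k
  c′  = shift e (ℚ.- c e) c
  b j = ℚ.- y ℚ.* c′ j

  supp-c′ : Supported I c′
  supp-c′ j j∉I with j ≟ᶠ e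
  ... | yes refl = trans (shift-same e (ℚ.- c e) c) (ℚₚ.+-inverseʳ (c e))
  ... | no  j≢e  = trans (shift-other e (ℚ.- c e) c j j≢e)
                         (supp j λ j∈ → case-∪ (x∈p∪q⁻ I ⁅ e ⁆ j∈))
    where
    case-∪ : ¬ (j ∈ I ⊎ j ∈ ⁅ e ⁆)
    case-∪ (inj₁ j∈I) = j∉I j∈I
    case-∪ (inj₂ j∈e) = j≢e (x∈⁅y⁆⇒x≡y e j∈e)

  supp-b : Supported I b
  supp-b j j∉I = trans (cong (ℚ.- y ℚ.*_) (supp-c′ j j∉I)) (ℚₚ.*-zeroʳ (ℚ.- y))

  spans : ∀ i → v e i ≡ sum (λ j → b j ℚ.* v j i)
  spans i = sym (begin
    sum (λ j → b j ℚ.* v j i)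
      ≡⟨ sum-cong-≗ (λ j → ℚₚ.*-assoc (ℚ.- y) (c′ j) (v j i)) ⟩
    sum (λ j → ℚ.- y ℚ.* (c′ j ℚ.* v j i))
      ≡⟨ *-distribˡ-sum (ℚ.- y) (λ j → c′ j ℚ.* v j i) ⟨
    ℚ.- y ℚ.* sum (λ j → c′ j ℚ.* v j i)
      ≡⟨ cong (ℚ.- y ℚ.*_) (sum-shift e (ℚ.- c e) c (λ j → v j i)) ⟩
    ℚ.- y ℚ.* (sum (λ j → c j ℚ.* v j i) ℚ.+ ℚ.- c e ℚ.* v e i)
      ≡⟨ cong (λ s → ℚ.- y ℚ.* (s ℚ.+ ℚ.- c e ℚ.* v e i)) (rel i ∈⊤) ⟩
    ℚ.- y ℚ.* (0ℚ ℚ.+ ℚ.- c e ℚ.* v e i)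
      ≡⟨ cong (ℚ.- y ℚ.*_) (ℚₚ.+-identityˡ (ℚ.- c e ℚ.* v e i)) ⟩
    ℚ.- y ℚ.* (ℚ.- c e ℚ.* v e i)
      ≡⟨ solve 3 (λ y c w → :- y :* (:- c :* w) := c :* y :* w)
           refl y (c e) (v e i) ⟩
    c e ℚ.* y ℚ.* v e i
      ≡⟨ cong (ℚ._* v e i) ce*y≡1 ⟩
    1ℚ ℚ.* v e i
      ≡⟨ ℚₚ.*-identityˡ (v e i) ⟩
    v e i
      ∎)

independent-in-span : (v : Vector (Vector ℚ m) k) (I J : Subset k) → Free ⊤ J v →
                      (∀ e → e ∈ J → InSpan v I (v e)) → ∣ J ∣ ℕ.≤ ∣ I ∣
independent-in-span {m} {k} v I J free spans = conclude (eliminate I J b)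
  where
  open ≡-Reasoning

  span : ∀ e → ∃[ b ] (Supported I b ×
                       (e ∈ J → ∀ i → v e i ≡ sum (λ j → b j ℚ.* v j i)))
  span e with e ∈? J
  ... | no e∉J = (λ _ → 0ℚ) , (λ _ _ → refl) , λ e∈J → ⊥-elim (e∉J e∈J)
  ... | yes e∈J with spans e e∈J
  ...   | b , supp , eq = b , supp , λ _ → eq

  b : Vector (Vector ℚ k) k
  b e = proj₁ (span e)

  conclude : Dependent I J b ⊎ (Free I J b × ∣ J ∣ ℕ.≤ ∣ I ∣) → ∣ J ∣ ℕ.≤ ∣ I ∣
  conclude (inj₂ (_ , J≤I)) = J≤I
  conclude (inj₁ (c , supp , nonzero , rel)) =
    ⊥-elim (dependent⇒¬free (c , supp , nonzero , rel′) free)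
    where
    column : ∀ j → sum (λ e → c e ℚ.* b e j) ≡ 0ℚ
    column = ∉-or-∈ I rel (λ j j∉I → sum-zero _ (λ e →
      trans (cong (c e ℚ.*_) (proj₁ (proj₂ (span e)) j j∉I)) (ℚₚ.*-zeroʳ (c e))))

    expand : ∀ i e → c e ℚ.* v e i ≡ sum (λ j → c e ℚ.* b e j ℚ.* v j i)
    expand i e = trans (∉-or-∈ J inJ outJ e) (trans
      (*-distribˡ-sum (c e) (λ j → b e j ℚ.* v j i))
      (sum-cong-≗ (λ j → sym (ℚₚ.*-assoc (c e) (b e j) (v j i)))))
      where
      inJ : ∀ e → e ∈ J →
            c e ℚ.* v e i ≡ c e ℚ.* sum (λ j → b e j ℚ.* v j i)
      inJ e e∈J = cong (c e ℚ.*_) (proj₂ (proj₂ (span e)) e∈J i)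

      outJ : ∀ e → e ∉ J →
             c e ℚ.* v e i ≡ c e ℚ.* sum (λ j → b e j ℚ.* v j i)
      outJ e e∉J = trans
        (trans (cong (ℚ._* v e i) (supp e e∉J)) (ℚₚ.*-zeroˡ (v e i)))
        (sym (trans (cong (ℚ._* s) (supp e e∉J)) (ℚₚ.*-zeroˡ s)))
        where s = sum (λ j → b e j ℚ.* v j i)

    rel′ : ∀ i → i ∈ ⊤ → sum (λ e → c e ℚ.* v e i) ≡ 0ℚ
    rel′ i _ = begin
      sum (λ e → c e ℚ.* v e i)
        ≡⟨ sum-cong-≗ (expand i) ⟩
      sum (λ e → sum (λ j → c e ℚ.* b e j ℚ.* v j i))
        ≡⟨ ∑-comm (λ e j → c e ℚ.* b e j ℚ.* v j i) ⟩
      sum (λ j → sum (λ e → c e ℚ.* b e j ℚ.* v j i))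
        ≡⟨ sum-cong-≗ (λ j → *-distribʳ-sum (v j i) (λ e → c e ℚ.* b e j)) ⟨
      sum (λ j → sum (λ e → c e ℚ.* b e j) ℚ.* v j i)
        ≡⟨ sum-zero _ (λ j → trans (cong (ℚ._* v j i) (column j))
                                   (ℚₚ.*-zeroˡ (v j i))) ⟩
      0ℚ
        ∎

vectorMatroid : Vector (Vector ℚ m) k → Matroid k
vectorMatroid v = record
  { Independent   = LinearlyIndependent v
  ; ⊥-independent = λ c rel j j∈⊥ → ⊥-elim (∉⊥ {x = j} j∈⊥)
  ; ⊆-independent = λ {I} {J} I⊆J ind → free⇒linearlyIndependent v I
      (λ c supp → linearlyIndependent⇒free v J ind c
                    (λ j j∉J → supp j (j∉J ∘ I⊆J)))
  ; augmentation  = augment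
  }
  where
  augment : ∀ {I J} → LinearlyIndependent v I → LinearlyIndependent v J →
            ∣ I ∣ ℕ.< ∣ J ∣ →
            ∃[ e ] (e ∈ J × e ∉ I × LinearlyIndependent v (I ∪ ⁅ e ⁆))
  augment {I} {J} indI indJ I<J
    with any? (λ e → (e ∈? J) ×-dec (¬? (e ∈? I) ×-dec
                       linearlyIndependent? v (I ∪ ⁅ e ⁆)))
  ... | yes found = found
  ... | no  none  = ⊥-elim (ℕₚ.<⇒≱ I<J
    (independent-in-span v I J (linearlyIndependent⇒free v J indJ) spans))
    where
    spans : ∀ e → e ∈ J → InSpan v I (v e)
    spans e e∈J with e ∈? I
    ... | yes e∈I = ∈⇒inSpan v I e e∈I
    ... | no  e∉I = dependent⇒inSpan v I e (linearlyIndependent⇒free v I indI)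
      (¬linearlyIndependent⇒dependent v (I ∪ ⁅ e ⁆)
        (λ ind → none (e , e∈J , e∉I , ind)))

{-# OPTIONS --safe #-}
module Submission where

-- The columns in S turn out to be independent exactly when S is sparse, so
-- the identity permutation is an isomorphism.
--
-- A final segment of l columns is zero outside the last ⌊l/2⌋ rows, which
-- bounds the number of independent columns in it.
--
-- Conversely, let B be the up-step set of a Dyck path. Let ω be the wedge of
-- all rows; its coefficient at B is the maximal minor on the columns B.
-- Contraction by a vector c is an antiderivation, so a relation c between the
-- columns annihilates ω; if c is supported in B, the coefficient of the
-- contraction at B without j is ± c_j ω(B). Hence ω(B) ≠ 0 forces c = 0.
-- Expanding row by row, ω(B) is a difference of two sums of products of
-- distinct entries, and matching the i-th element of B with the i-th row
-- gives a term occurring in only one of them. By genericity ω(B) ≠ 0.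

open import Defs
open import Data.Fin.Base using (Fin)
open import Data.Integer.Base using (ℤ; 0ℤ)
open import Data.Nat.Base using (ℕ; _*_; NonZero)
open import Data.Vec.Functional using (fromList)
open import Relation.Binary.PropositionalEquality using (_≡_)
open import Relation.Nullary using (¬_)

open import Algebra.Bundles using (CommutativeRing)
import Algebra.Properties.Semiring.Sum as SemiringSum
open import Data.Bool.Base using (Bool; true; false; if_then_else_)
open import Data.Empty using (⊥-elim)
open import Data.Fin.Base using (zero; suc; toℕ)
open import Data.Fin.Permutation using () renaming (id to idₚ)
open import Data.Fin.Subset
open import Data.Fin.Subset.Properties
import Data.Integer.Base as ℤ
import Data.Integer.Properties as ℤₚ
open import Data.Integer.Solver using () renaming (module +-*-Solver to ℤ-Solver)
open import Data.List.Base using (List; []; _∷_; _++_; allFin; cartesianProduct; filter; length; map;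
                                 tabulate)
open import Data.Nat.Base as ℕ using (zero; suc; z≤n; s≤s)
import Data.Nat.Coprimality as Coprime
import Data.Nat.Properties as ℕₚ
open import Data.Product.Base using (∃-syntax; _×_; _,_; proj₁)
open import Data.Rational.Base as ℚ using (ℚ; 0ℚ; 1ℚ)
import Data.Rational.Properties as ℚₚ
open import Data.Rational.Solver using (module +-*-Solver)
open import Data.Sum.Base using (inj₁; inj₂)
open import Data.Vec.Base as Vec using ([]; _∷_; here; there; _[_]≔_)
import Data.Vec.Properties as Vecₚ
open import Data.Vec.Functional using (Vector)
open import Function.Base using (_∘_; id)
open import Function.Bundles using (mk⇔)
open import Relation.Binary.PropositionalEquality
open import Relation.Nullary using (Dec; yes; no; does)
open import Relation.Nullary.Decidable using (dec-true)

open SemiringSum (CommutativeRing.semiring ℚₚ.+-*-commutativeRing)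
  using (sum)

private
  variable
    k l m n : ℕ

-- Exterior algebra

-- The value at S is the coefficient of the wedge of the basis vectors
-- e_j, j ∈ S, taken in increasing order.
Form : ℕ → Set
Form k = Subset k → ℚ

-- Left exterior multiplication by the vector `v`. In the `inside` case the minus sign comes from
-- moving the later coordinates of `v` past the first basis vector.
wedge : Vector ℚ k → Form k → Form k
wedge v w []            = 0ℚ
wedge v w (outside ∷ S) = wedge (v ∘ suc) (w ∘ (outside ∷_)) S
wedge v w (inside ∷ S)  =
  v zero ℚ.* w (outside ∷ S) ℚ.- wedge (v ∘ suc) (w ∘ (inside ∷_)) S

-- The interior product with the functional sending the j-th basis vector to `c j`, with the same
-- sign rule as `wedge`.
contract : Vector ℚ k → Form k → Form k
contract c w []            = 0ℚ
contract c w (outside ∷ S) =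
  c zero ℚ.* w (inside ∷ S) ℚ.+ contract (c ∘ suc) (w ∘ (outside ∷_)) S
contract c w (inside ∷ S)  = ℚ.- contract (c ∘ suc) (w ∘ (inside ∷_)) S

unit : Form k
unit []            = 1ℚ
unit (outside ∷ S) = unit S
unit (inside ∷ S)  = 0ℚ

⋀ : (Fin m → Vector ℚ k) → Form k
⋀ {zero}  r = unit
⋀ {suc m} r = wedge (r zero) (⋀ (r ∘ suc))

module _ where
  open ≡-Reasoning
  open +-*-Solver

  wedge-linear : ∀ (v : Vector ℚ k) t w w′ S →
    wedge v (λ T → t ℚ.* w T ℚ.+ w′ T) S ≡ t ℚ.* wedge v w S ℚ.+ wedge v w′ S
  wedge-linear v t w w′ [] = solve 1 (λ t → con 0ℚ := t :* con 0ℚ :+ con 0ℚ) refl t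
  wedge-linear v t w w′ (outside ∷ S) =
    wedge-linear (v ∘ suc) t (w ∘ (outside ∷_)) (w′ ∘ (outside ∷_)) S
  wedge-linear v t w w′ (inside ∷ S) = trans
    (cong (λ z → v zero ℚ.* (t ℚ.* w (outside ∷ S) ℚ.+ w′ (outside ∷ S)) ℚ.- z)
      (wedge-linear (v ∘ suc) t (w ∘ (inside ∷_)) (w′ ∘ (inside ∷_)) S))
    (solve 6 (λ a t x x′ y y′ →
        a :* (t :* x :+ x′) :- (t :* y :+ y′) := t :* (a :* x :- y) :+ (a :* x′ :- y′))
      refl (v zero) t (w (outside ∷ S)) (w′ (outside ∷ S))
      (wedge (v ∘ suc) (w ∘ (inside ∷_)) S) (wedge (v ∘ suc) (w′ ∘ (inside ∷_)) S))

  wedge-neg : ∀ (v : Vector ℚ k) w S → wedge v (ℚ.-_ ∘ w) S ≡ ℚ.- wedge v w S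
  wedge-neg v w [] = refl
  wedge-neg v w (outside ∷ S) = wedge-neg (v ∘ suc) (w ∘ (outside ∷_)) S
  wedge-neg v w (inside ∷ S) = trans
    (cong (λ z → v zero ℚ.* ℚ.- w (outside ∷ S) ℚ.- z)
      (wedge-neg (v ∘ suc) (w ∘ (inside ∷_)) S))
    (solve 3 (λ a x y → a :* :- x :- :- y := :- (a :* x :- y)) refl
      (v zero) (w (outside ∷ S)) (wedge (v ∘ suc) (w ∘ (inside ∷_)) S))

  wedge-zero : ∀ (v : Vector ℚ k) w → (∀ T → w T ≡ 0ℚ) → ∀ S → wedge v w S ≡ 0ℚ
  wedge-zero v w w≡0 [] = refl
  wedge-zero v w w≡0 (outside ∷ S) =
    wedge-zero (v ∘ suc) (w ∘ (outside ∷_)) (λ T → w≡0 (outside ∷ T)) S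
  wedge-zero v w w≡0 (inside ∷ S) = trans
    (cong₂ (λ x y → v zero ℚ.* x ℚ.- y) (w≡0 (outside ∷ S))
      (wedge-zero (v ∘ suc) (w ∘ (inside ∷_)) (λ T → w≡0 (inside ∷ T)) S))
    (solve 1 (λ a → a :* con 0ℚ :- con 0ℚ := con 0ℚ) refl (v zero))

  contract-linear : ∀ (c : Vector ℚ k) t w w′ S →
    contract c (λ T → t ℚ.* w T ℚ.+ w′ T) S ≡
    t ℚ.* contract c w S ℚ.+ contract c w′ S
  contract-linear c t w w′ [] = solve 1 (λ t → con 0ℚ := t :* con 0ℚ :+ con 0ℚ) refl t
  contract-linear c t w w′ (outside ∷ S) = trans
    (cong (c zero ℚ.* (t ℚ.* w (inside ∷ S) ℚ.+ w′ (inside ∷ S)) ℚ.+_)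
      (contract-linear (c ∘ suc) t (w ∘ (outside ∷_)) (w′ ∘ (outside ∷_)) S))
    (solve 6 (λ a t x x′ y y′ →
        a :* (t :* x :+ x′) :+ (t :* y :+ y′) := t :* (a :* x :+ y) :+ (a :* x′ :+ y′))
      refl (c zero) t (w (inside ∷ S)) (w′ (inside ∷ S))
      (contract (c ∘ suc) (w ∘ (outside ∷_)) S) (contract (c ∘ suc) (w′ ∘ (outside ∷_)) S))
  contract-linear c t w w′ (inside ∷ S) = trans
    (cong ℚ.-_ (contract-linear (c ∘ suc) t (w ∘ (inside ∷_)) (w′ ∘ (inside ∷_)) S))
    (solve 3 (λ t y y′ → :- (t :* y :+ y′) := t :* :- y :+ :- y′) refl
      t (contract (c ∘ suc) (w ∘ (inside ∷_)) S) (contract (c ∘ suc) (w′ ∘ (inside ∷_)) S))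

  contract-neg : ∀ (c : Vector ℚ k) w S → contract c (ℚ.-_ ∘ w) S ≡ ℚ.- contract c w S
  contract-neg c w [] = refl
  contract-neg c w (outside ∷ S) = trans
    (cong (c zero ℚ.* ℚ.- w (inside ∷ S) ℚ.+_)
      (contract-neg (c ∘ suc) (w ∘ (outside ∷_)) S))
    (solve 3 (λ a x y → a :* :- x :+ :- y := :- (a :* x :+ y)) refl
      (c zero) (w (inside ∷ S)) (contract (c ∘ suc) (w ∘ (outside ∷_)) S))
  contract-neg c w (inside ∷ S) = cong ℚ.-_ (contract-neg (c ∘ suc) (w ∘ (inside ∷_)) S)

  contract-zero : ∀ (c : Vector ℚ k) S → contract c (λ _ → 0ℚ) S ≡ 0ℚ
  contract-zero c [] = refl
  contract-zero c (outside ∷ S) = trans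
    (cong (c zero ℚ.* 0ℚ ℚ.+_) (contract-zero (c ∘ suc) S))
    (solve 1 (λ a → a :* con 0ℚ :+ con 0ℚ := con 0ℚ) refl (c zero))
  contract-zero c (inside ∷ S) = cong ℚ.-_ (contract-zero (c ∘ suc) S)

  contract-unit : ∀ (c : Vector ℚ k) S → contract c unit S ≡ 0ℚ
  contract-unit c [] = refl
  contract-unit c (outside ∷ S) = trans
    (cong (c zero ℚ.* 0ℚ ℚ.+_) (contract-unit (c ∘ suc) S))
    (solve 1 (λ a → a :* con 0ℚ :+ con 0ℚ := con 0ℚ) refl (c zero))
  contract-unit c (inside ∷ S) = cong ℚ.-_ (contract-zero (c ∘ suc) S)

  -- The antiderivation rule, by splitting off the first basis vector. The mixed terms cancel: `c₀`
  -- times a wedge in the `outside` case, `v₀` times a contraction in the `inside` case.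
  contract-wedge : ∀ (c v : Vector ℚ k) w S →
    contract c (wedge v w) S ℚ.+ wedge v (contract c w) S ≡
    sum (λ j → c j ℚ.* v j) ℚ.* w S
  contract-wedge c v w [] = sym (ℚₚ.*-zeroˡ (w []))
  contract-wedge c v w (outside ∷ S) = begin
    c₀ ℚ.* (v₀ ℚ.* w₀ S ℚ.- wedge v′ w₁ S) ℚ.+ contract c′ (wedge v′ w₀) S ℚ.+
      wedge v′ (λ T → c₀ ℚ.* w₁ T ℚ.+ contract c′ w₀ T) S
      ≡⟨ cong (c₀ ℚ.* (v₀ ℚ.* w₀ S ℚ.- wedge v′ w₁ S) ℚ.+ contract c′ (wedge v′ w₀) S ℚ.+_)
           (wedge-linear v′ c₀ w₁ (contract c′ w₀) S) ⟩
    c₀ ℚ.* (v₀ ℚ.* w₀ S ℚ.- wedge v′ w₁ S) ℚ.+ contract c′ (wedge v′ w₀) S ℚ.+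
      (c₀ ℚ.* wedge v′ w₁ S ℚ.+ wedge v′ (contract c′ w₀) S)
      ≡⟨ solve 6 (λ c v x y z u → c :* (v :* x :- y) :+ z :+ (c :* y :+ u) :=
                                  c :* v :* x :+ (z :+ u))
           refl c₀ v₀ (w₀ S) (wedge v′ w₁ S) (contract c′ (wedge v′ w₀) S)
           (wedge v′ (contract c′ w₀) S) ⟩
    c₀ ℚ.* v₀ ℚ.* w₀ S ℚ.+ (contract c′ (wedge v′ w₀) S ℚ.+ wedge v′ (contract c′ w₀) S)
      ≡⟨ cong (c₀ ℚ.* v₀ ℚ.* w₀ S ℚ.+_) (contract-wedge c′ v′ w₀ S) ⟩
    c₀ ℚ.* v₀ ℚ.* w₀ S ℚ.+ sum (λ j → c′ j ℚ.* v′ j) ℚ.* w₀ S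
      ≡⟨ ℚₚ.*-distribʳ-+ (w₀ S) (c₀ ℚ.* v₀) _ ⟨
    (c₀ ℚ.* v₀ ℚ.+ sum (λ j → c′ j ℚ.* v′ j)) ℚ.* w₀ S
      ∎
    where
    c₀ = c zero
    v₀ = v zero
    c′ = c ∘ suc
    v′ = v ∘ suc
    w₀ = w ∘ (outside ∷_)
    w₁ = w ∘ (inside ∷_)
  contract-wedge c v w (inside ∷ S) = begin
    ℚ.- contract c′ (λ T → v₀ ℚ.* w₀ T ℚ.- wedge v′ w₁ T) S ℚ.+
      (v₀ ℚ.* (c₀ ℚ.* w₁ S ℚ.+ contract c′ w₀ S) ℚ.-
       wedge v′ (λ T → ℚ.- contract c′ w₁ T) S)
      ≡⟨ cong₂ (λ x y → ℚ.- x ℚ.+ (v₀ ℚ.* (c₀ ℚ.* w₁ S ℚ.+ contract c′ w₀ S) ℚ.- y))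
           (trans (contract-linear c′ v₀ w₀ (ℚ.-_ ∘ wedge v′ w₁) S)
                  (cong (v₀ ℚ.* contract c′ w₀ S ℚ.+_) (contract-neg c′ (wedge v′ w₁) S)))
           (wedge-neg v′ (contract c′ w₁) S) ⟩
    ℚ.- (v₀ ℚ.* contract c′ w₀ S ℚ.- contract c′ (wedge v′ w₁) S) ℚ.+
      (v₀ ℚ.* (c₀ ℚ.* w₁ S ℚ.+ contract c′ w₀ S) ℚ.- ℚ.- wedge v′ (contract c′ w₁) S)
      ≡⟨ solve 6 (λ c v x y z u → :- (v :* y :- z) :+ (v :* (c :* x :+ y) :- :- u) :=
                                  c :* v :* x :+ (z :+ u))
           refl c₀ v₀ (w₁ S) (contract c′ w₀ S) (contract c′ (wedge v′ w₁) S)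
           (wedge v′ (contract c′ w₁) S) ⟩
    c₀ ℚ.* v₀ ℚ.* w₁ S ℚ.+ (contract c′ (wedge v′ w₁) S ℚ.+ wedge v′ (contract c′ w₁) S)
      ≡⟨ cong (c₀ ℚ.* v₀ ℚ.* w₁ S ℚ.+_) (contract-wedge c′ v′ w₁ S) ⟩
    c₀ ℚ.* v₀ ℚ.* w₁ S ℚ.+ sum (λ j → c′ j ℚ.* v′ j) ℚ.* w₁ S
      ≡⟨ ℚₚ.*-distribʳ-+ (w₁ S) (c₀ ℚ.* v₀) _ ⟨
    (c₀ ℚ.* v₀ ℚ.+ sum (λ j → c′ j ℚ.* v′ j)) ℚ.* w₁ S
      ∎
    where
    c₀ = c zero
    v₀ = v zero
    c′ = c ∘ suc
    v′ = v ∘ suc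
    w₀ = w ∘ (outside ∷_)
    w₁ = w ∘ (inside ∷_)

-- Since `c` pairs to zero with every row, contraction anticommutes with wedging by each row and so
-- moves inward to `unit`, which it kills.
contract-⋀ : ∀ (c : Vector ℚ k) (r : Fin m → Vector ℚ k) →
             (∀ i → sum (λ j → c j ℚ.* r i j) ≡ 0ℚ) → ∀ S → contract c (⋀ r) S ≡ 0ℚ
contract-⋀ {m = zero}  c r c⊥r S = contract-unit c S
contract-⋀ {m = suc m} c r c⊥r S = begin
  contract c (wedge (r zero) w) S
    ≡⟨ ℚₚ.+-identityʳ _ ⟨
  contract c (wedge (r zero) w) S ℚ.+ 0ℚ
    ≡⟨ cong (contract c (wedge (r zero) w) S ℚ.+_)
         (wedge-zero (r zero) (contract c w) (contract-⋀ c (r ∘ suc) (c⊥r ∘ suc)) S) ⟨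
  contract c (wedge (r zero) w) S ℚ.+ wedge (r zero) (contract c w) S
    ≡⟨ contract-wedge c (r zero) w S ⟩
  sum (λ j → c j ℚ.* r zero j) ℚ.* w S
    ≡⟨ cong (ℚ._* w S) (c⊥r zero) ⟩
  0ℚ ℚ.* w S
    ≡⟨ ℚₚ.*-zeroˡ (w S) ⟩
  0ℚ
    ∎
  where
  open ≡-Reasoning
  w = ⋀ (r ∘ suc)

supported-tail : ∀ {x} {S : Subset k} {c} → Supported (x ∷ S) c → Supported S (c ∘ suc)
supported-tail supp j j∉S = supp (suc j) (j∉S ∘ drop-there)

-- Each term of the contraction at `S` inserts some j outside `S` and carries the factor `c j`,
-- which vanishes.
contract-supported : ∀ (c : Vector ℚ k) w S → Supported S c → contract c w S ≡ 0ℚ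
contract-supported c w [] supp = refl
contract-supported c w (outside ∷ S) supp = trans
  (cong₂ (λ x y → x ℚ.* w (inside ∷ S) ℚ.+ y) (supp zero λ ())
    (contract-supported (c ∘ suc) (w ∘ (outside ∷_)) S (supported-tail supp)))
  (trans (ℚₚ.+-identityʳ _) (ℚₚ.*-zeroˡ (w (inside ∷ S))))
contract-supported c w (inside ∷ S) supp =
  cong ℚ.-_ (contract-supported (c ∘ suc) (w ∘ (inside ∷_)) S (supported-tail supp))

-- Up to sign, c j * w S is the value of contract c w at S without j.
contract-coefficient : ∀ (c : Vector ℚ k) w S → Supported S c →
  (∀ T → contract c w T ≡ 0ℚ) → ∀ j → j ∈ S → c j ℚ.* w S ≡ 0ℚ
contract-coefficient c w (inside ∷ S) supp ≡0 zero here = begin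
  c zero ℚ.* w (inside ∷ S)
    ≡⟨ ℚₚ.+-identityʳ _ ⟨
  c zero ℚ.* w (inside ∷ S) ℚ.+ 0ℚ
    ≡⟨ cong (c zero ℚ.* w (inside ∷ S) ℚ.+_)
         (contract-supported (c ∘ suc) (w ∘ (outside ∷_)) S (supported-tail supp)) ⟨
  contract c w (outside ∷ S)
    ≡⟨ ≡0 (outside ∷ S) ⟩
  0ℚ
    ∎
  where open ≡-Reasoning
contract-coefficient c w (inside ∷ S) supp ≡0 (suc j) (there j∈S) =
  contract-coefficient (c ∘ suc) (w ∘ (inside ∷_)) S (supported-tail supp)
    (λ T → ℚₚ.neg-injective (≡0 (inside ∷ T))) j j∈S
contract-coefficient c w (outside ∷ S) supp ≡0 (suc j) (there j∈S) =
  contract-coefficient (c ∘ suc) (w ∘ (outside ∷_)) S (supported-tail supp) ≡0′ j j∈S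
  where
  open ≡-Reasoning
  ≡0′ : ∀ T → contract (c ∘ suc) (w ∘ (outside ∷_)) T ≡ 0ℚ
  ≡0′ T = begin
    contract (c ∘ suc) (w ∘ (outside ∷_)) T
      ≡⟨ ℚₚ.+-identityˡ _ ⟨
    0ℚ ℚ.+ contract (c ∘ suc) (w ∘ (outside ∷_)) T
      ≡⟨ cong (ℚ._+ contract (c ∘ suc) (w ∘ (outside ∷_)) T)
           (trans (cong (ℚ._* w (inside ∷ T)) (supp zero λ ())) (ℚₚ.*-zeroˡ (w (inside ∷ T)))) ⟨
    contract c w (outside ∷ T)
      ≡⟨ ≡0 (outside ∷ T) ⟩
    0ℚ
      ∎

⋀≢0⇒free : ∀ (v : Vector (Vector ℚ m) k) S → ⋀ (λ i j → v j i) S ≢ 0ℚ → Free ⊤ S v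
⋀≢0⇒free v S ⋀≢0 c supp rel = ∉-or-∈ S
  (λ j j∈S → *-zero-cancelʳ (c j) _ ⋀≢0
    (contract-coefficient c _ S supp
      (contract-⋀ c (λ i j → v j i) (λ i → rel i ∈⊤)) j j∈S))
  supp

-- Signed sums of subset products

∑-subsets-cong : {f g : Subset k → ℤ} → (∀ S → f S ≡ g S) → ∑-subsets f ≡ ∑-subsets g
∑-subsets-cong {zero}  f≗g = f≗g []
∑-subsets-cong {suc k} f≗g = cong₂ ℤ._+_
  (∑-subsets-cong (λ S → f≗g (outside ∷ S))) (∑-subsets-cong (λ S → f≗g (inside ∷ S)))

∑-subsets-zero : ∀ k → ∑-subsets {k} (λ _ → 0ℤ) ≡ 0ℤ
∑-subsets-zero zero    = refl
∑-subsets-zero (suc k) = cong₂ ℤ._+_ (∑-subsets-zero k) (∑-subsets-zero k)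

*-distribˡ-∑-subsets : ∀ x (f : Subset k → ℤ) →
                       x ℤ.* ∑-subsets f ≡ ∑-subsets (λ S → x ℤ.* f S)
*-distribˡ-∑-subsets {zero}  x f = refl
*-distribˡ-∑-subsets {suc k} x f = trans
  (ℤₚ.*-distribˡ-+ x _ _)
  (cong₂ ℤ._+_ (*-distribˡ-∑-subsets x (f ∘ (outside ∷_)))
               (*-distribˡ-∑-subsets x (f ∘ (inside ∷_))))

-- A family sum is affine in its first variable. Read backwards, this builds a family from two
-- families in one variable fewer, as in `nodeˢ`.
familySum-∷ : ∀ (x : Vector ℤ (suc k)) F →
  familySum x F ≡ familySum (x ∘ suc) (F ∘ (outside ∷_)) ℤ.+
                  x zero ℤ.* familySum (x ∘ suc) (F ∘ (inside ∷_))
familySum-∷ x F = cong₂ ℤ._+_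
  (∑-subsets-cong (λ S → cong (λ z → if F (outside ∷ S) then z else 0ℤ)
    (ℤₚ.*-identityˡ (∏∈ S (x ∘ suc)))))
  (trans (∑-subsets-cong pull) (sym (*-distribˡ-∑-subsets (x zero)
    (λ S → if F (inside ∷ S) then ∏∈ S (x ∘ suc) else 0ℤ))))
  where
  pull : ∀ S → (if F (inside ∷ S) then x zero ℤ.* ∏∈ S (x ∘ suc) else 0ℤ) ≡
               x zero ℤ.* (if F (inside ∷ S) then ∏∈ S (x ∘ suc) else 0ℤ)
  pull S with F (inside ∷ S)
  ... | true  = refl
  ... | false = sym (ℤₚ.*-zeroʳ (x zero))

-- For a variable `z` the quotient `z / 1` does not reduce. The constructor form exposes numerator
-- and denominator, which gives injectivity and compatibility with sums and products.
/1≡mkℚ : ∀ z → z ℚ./ 1 ≡ ℚ.mkℚ z 0 (Coprime.sym (Coprime.1-coprimeTo ℤ.∣ z ∣))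
/1≡mkℚ z = ℚₚ.fromℚᵘ-toℚᵘ (ℚ.mkℚ z 0 _)

/1-injective : ∀ {y z} → y ℚ./ 1 ≡ z ℚ./ 1 → y ≡ z
/1-injective {y} {z} eq =
  proj₁ (ℚₚ.mkℚ-injective (trans (sym (/1≡mkℚ y)) (trans eq (/1≡mkℚ z))))

/1-homo-+ : ∀ y z → (y ℤ.+ z) ℚ./ 1 ≡ y ℚ./ 1 ℚ.+ z ℚ./ 1
/1-homo-+ y z = sym (trans (cong₂ ℚ._+_ (/1≡mkℚ y) (/1≡mkℚ z))
  (cong (ℚ._/ 1) (cong₂ ℤ._+_ (ℤₚ.*-identityʳ y) (ℤₚ.*-identityʳ z))))

/1-homo-* : ∀ y z → (y ℤ.* z) ℚ./ 1 ≡ y ℚ./ 1 ℚ.* (z ℚ./ 1)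
/1-homo-* y z = sym (cong₂ ℚ._*_ (/1≡mkℚ y) (/1≡mkℚ z))

/1-homo-neg : ∀ z → (ℤ.- z) ℚ./ 1 ≡ ℚ.- (z ℚ./ 1)
/1-homo-neg (ℤ.+ zero)  = refl
/1-homo-neg (ℤ.+ suc _) = refl
/1-homo-neg ℤ.-[1+ n ]  = solve 1 (λ z → z := :- :- z) refl (ℤ.+ suc n ℚ./ 1)
  where open +-*-Solver

-- Multilinear polynomials with coefficients in {-1, 0, 1} are written as
-- differences of two family sums.
record SignedSum (xs : List ℤ) (z : ℚ) : Set where
  field
    plus minus : Subset (length xs) → Bool
    value      : z ≡ (familySum (fromList xs) plus ℤ.-
                      familySum (fromList xs) minus) ℚ./ 1

  Nontrivial : Set
  Nontrivial = ∃[ S ] plus S ≢ minus S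

open SignedSum

-- The only place where genericity enters: the value zero makes the two family sums equal, hence
-- also the two families.
generic⇒≢0 : ∀ {xs z} (s : SignedSum xs z) → Nontrivial s →
             Generic (fromList xs) → z ≢ 0ℚ
generic⇒≢0 s (S , plus≢minus) generic z≡0 = plus≢minus (generic (plus s) (minus s)
  (ℤₚ.i-j≡0⇒i≡j _ _ (/1-injective (trans (sym (value s)) z≡0))) S)

zeroˢ : ∀ {xs} → SignedSum xs 0ℚ
zeroˢ {xs} = record
  { plus  = λ _ → false
  ; minus = λ _ → false
  ; value = sym (cong (ℚ._/ 1)
      (cong₂ ℤ._-_ (∑-subsets-zero (length xs)) (∑-subsets-zero (length xs))))
  }

oneˢ : SignedSum [] 1ℚ
oneˢ = record { plus = λ _ → true ; minus = λ _ → false ; value = refl }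

negˢ : ∀ {xs z} → SignedSum xs z → SignedSum xs (ℚ.- z)
negˢ {xs} s = record
  { plus  = minus s
  ; minus = plus s
  ; value = trans (cong ℚ.-_ (value s)) (trans (sym (/1-homo-neg (p ℤ.- q)))
      (cong (ℚ._/ 1) (solve 2 (λ p q → :- (p :- q) := q :- p) refl p q)))
  }
  where
  open ℤ-Solver
  p = familySum (fromList xs) (plus s)
  q = familySum (fromList xs) (minus s)

nodeˢ : ∀ {xs y z} x → SignedSum xs y → SignedSum xs z →
        SignedSum (x ∷ xs) (x ℚ./ 1 ℚ.* y ℚ.+ z)
nodeˢ {xs} {y} {z} x s t = record
  { plus  = plus′
  ; minus = minus′
  ; value = begin
      x ℚ./ 1 ℚ.* y ℚ.+ z
        ≡⟨ cong₂ (λ y z → x ℚ./ 1 ℚ.* y ℚ.+ z) (value s) (value t) ⟩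
      x ℚ./ 1 ℚ.* ((Σ (plus s) ℤ.- Σ (minus s)) ℚ./ 1) ℚ.+ (Σ (plus t) ℤ.- Σ (minus t)) ℚ./ 1
        ≡⟨ cong (ℚ._+ (Σ (plus t) ℤ.- Σ (minus t)) ℚ./ 1)
             (/1-homo-* x (Σ (plus s) ℤ.- Σ (minus s))) ⟨
      (x ℤ.* (Σ (plus s) ℤ.- Σ (minus s))) ℚ./ 1 ℚ.+ (Σ (plus t) ℤ.- Σ (minus t)) ℚ./ 1
        ≡⟨ /1-homo-+ (x ℤ.* (Σ (plus s) ℤ.- Σ (minus s))) (Σ (plus t) ℤ.- Σ (minus t)) ⟨
      (x ℤ.* (Σ (plus s) ℤ.- Σ (minus s)) ℤ.+ (Σ (plus t) ℤ.- Σ (minus t))) ℚ./ 1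
        ≡⟨ cong (ℚ._/ 1) (solve 5 (λ x p m p′ m′ →
             x :* (p :- m) :+ (p′ :- m′) := (p′ :+ x :* p) :- (m′ :+ x :* m))
             refl x (Σ (plus s)) (Σ (minus s)) (Σ (plus t)) (Σ (minus t))) ⟩
      ((Σ (plus t) ℤ.+ x ℤ.* Σ (plus s)) ℤ.- (Σ (minus t) ℤ.+ x ℤ.* Σ (minus s))) ℚ./ 1
        ≡⟨ cong (ℚ._/ 1) (cong₂ ℤ._-_ (familySum-∷ x∷xs plus′) (familySum-∷ x∷xs minus′)) ⟨
      (familySum x∷xs plus′ ℤ.- familySum x∷xs minus′) ℚ./ 1
        ∎
  }
  where
  open ≡-Reasoning
  open ℤ-Solver

  x∷xs = fromList (x ∷ xs)
  Σ = familySum (fromList xs)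

  plus′ minus′ : Subset (suc (length xs)) → Bool
  plus′ (outside ∷ S)  = plus t S
  plus′ (inside ∷ S)   = plus s S
  minus′ (outside ∷ S) = minus t S
  minus′ (inside ∷ S)  = minus s S

castˢ : ∀ {xs y z} → y ≡ z → SignedSum xs y → SignedSum xs z
castˢ y≡z s = record { plus = plus s ; minus = minus s ; value = trans (sym y≡z) (value s) }

skipˢ : ∀ {xs z} x → SignedSum xs z → SignedSum (x ∷ xs) z
skipˢ {z = z} x s = castˢ
  (trans (cong (ℚ._+ z) (ℚₚ.*-zeroʳ (x ℚ./ 1))) (ℚₚ.+-identityˡ z)) (nodeˢ x zeroˢ s)

-- Determinants of matrices with a prescribed zero pattern

module _ (A : Matrix ℤ m n) {P : Fin m → Fin n → Set} (P? : ∀ i j → Dec (P i j))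
         (A≡0 : ∀ i j → ¬ P i j → A i j ≡ 0ℤ) where

  row : Fin m → (Fin l → Fin n) → Vector ℚ l
  row i g j = A i (g j) ℚ./ 1

  -- Expanding along row i from left to right introduces its entries in
  -- exactly the order in which they are listed in front of xs.
  infixr 5 _⟨_⟩++_

  _⟨_⟩++_ : Fin m → (Fin l → Fin n) → List ℤ → List ℤ
  _⟨_⟩++_ {zero}  i g xs = xs
  _⟨_⟩++_ {suc l} i g xs = if does (P? i (g zero))
    then A i (g zero) ∷ i ⟨ g ∘ suc ⟩++ xs else i ⟨ g ∘ suc ⟩++ xs

  -- Once row `i` has contributed its factor to a product, its remaining entries are still variables
  -- but must not occur.
  padˢ : ∀ {xs z} i (g : Fin l → Fin n) → SignedSum xs z → SignedSum (i ⟨ g ⟩++ xs) z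
  padˢ {zero}  i g s = s
  padˢ {suc l} i g s with P? i (g zero)
  ... | yes _ = skipˢ (A i (g zero)) (padˢ i (g ∘ suc) s)
  ... | no  _ = padˢ i (g ∘ suc) s

  padˢ-nontrivial : ∀ {xs z} i (g : Fin l → Fin n) (s : SignedSum xs z) →
                    Nontrivial s → Nontrivial (padˢ i g s)
  padˢ-nontrivial {zero}  i g s nt = nt
  padˢ-nontrivial {suc l} i g s nt with P? i (g zero)
  ... | yes _ with T , p ← padˢ-nontrivial i (g ∘ suc) s nt = outside ∷ T , p
  ... | no  _ = padˢ-nontrivial i (g ∘ suc) s nt

  wedgeˢ : ∀ {xs} i (g : Fin l → Fin n) {w : Form l} → (∀ S → SignedSum xs (w S)) →
           ∀ S → SignedSum (i ⟨ g ⟩++ xs) (wedge (row i g) w S)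
  wedgeˢ i g s [] = zeroˢ
  wedgeˢ i g s (x ∷ S) with P? i (g zero)
  wedgeˢ i g s (outside ∷ S) | yes _ =
    skipˢ (A i (g zero)) (wedgeˢ i (g ∘ suc) (s ∘ (outside ∷_)) S)
  wedgeˢ i g s (outside ∷ S) | no _ =
    wedgeˢ i (g ∘ suc) (s ∘ (outside ∷_)) S
  wedgeˢ i g s (inside ∷ S) | yes _ =
    nodeˢ (A i (g zero)) (padˢ i (g ∘ suc) (s (outside ∷ S)))
          (negˢ (wedgeˢ i (g ∘ suc) (s ∘ (inside ∷_)) S))
  -- An entry outside the pattern is not among the variables; being zero, it removes the first term
  -- of the expansion.
  wedgeˢ i g {w} s (inside ∷ S) | no ¬p₀ =
    castˢ (begin
        ℚ.- y                     ≡⟨ ℚₚ.+-identityˡ (ℚ.- y) ⟨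
        0ℚ ℚ.- y                  ≡⟨ cong (ℚ._- y) (ℚₚ.*-zeroˡ x) ⟨
        0ℚ ℚ.* x ℚ.- y            ≡⟨ cong (λ a → a ℚ./ 1 ℚ.* x ℚ.- y) (A≡0 i (g zero) ¬p₀) ⟨
        row i g zero ℚ.* x ℚ.- y  ∎)
      (negˢ (wedgeˢ i (g ∘ suc) (s ∘ (inside ∷_)) S))
    where
    open ≡-Reasoning
    x = w (outside ∷ S)
    y = wedge (row i (g ∘ suc)) (w ∘ (inside ∷_)) S

  -- The monomials whose only factor from row `i` is the entry in column `g j` have, up to sign, the
  -- coefficients of the form at `S` without `j`. A nonzero coefficient there therefore survives.
  wedgeˢ-nontrivial : ∀ {xs} i (g : Fin l → Fin n) {w : Form l}
    (s : ∀ S → SignedSum xs (w S)) {S} j → j ∈ S → P i (g j) →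
    Nontrivial (s (S [ j ]≔ outside)) → Nontrivial (wedgeˢ i g s S)
  wedgeˢ-nontrivial i g s {inside ∷ S} zero here pj nt with P? i (g zero)
  ... | yes _ with T , p ← padˢ-nontrivial i (g ∘ suc) (s (outside ∷ S)) nt = inside ∷ T , p
  ... | no ¬p₀ = ⊥-elim (¬p₀ pj)
  wedgeˢ-nontrivial i g s {x ∷ S} (suc j) (there j∈S) pj nt
    with T , p ← wedgeˢ-nontrivial i (g ∘ suc) (s ∘ (x ∷_)) j j∈S pj nt
    with P? i (g zero)
  -- Passing an element of `S` changes the sign, so `negˢ` swaps the two families.
  wedgeˢ-nontrivial i g s {inside ∷ S} (suc j) (there j∈S) pj nt | yes _ = outside ∷ T , p ∘ sym
  wedgeˢ-nontrivial i g s {inside ∷ S} (suc j) (there j∈S) pj nt | no _ = T , p ∘ sym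
  wedgeˢ-nontrivial i g s {outside ∷ S} (suc j) (there j∈S) pj nt | yes _ = outside ∷ T , p
  wedgeˢ-nontrivial i g s {outside ∷ S} (suc j) (there j∈S) pj nt | no _ = T , p

  entries : (Fin l → Fin m) → List ℤ
  entries {zero}  h = []
  entries {suc l} h = h zero ⟨ id ⟩++ entries (h ∘ suc)

  unitˢ : ∀ (S : Subset l) → SignedSum [] (unit S)
  unitˢ []            = oneˢ
  unitˢ (outside ∷ S) = unitˢ S
  unitˢ (inside ∷ S)  = zeroˢ

  unitˢ-nontrivial : ∀ (S : Subset l) → ∣ S ∣ ≡ 0 → Nontrivial (unitˢ S)
  unitˢ-nontrivial []            _  = [] , λ ()
  unitˢ-nontrivial (outside ∷ S) eq = unitˢ-nontrivial S eq

  ⋀ˢ : ∀ (h : Fin l → Fin m) S → SignedSum (entries h) (⋀ (λ i → row (h i) id) S)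
  ⋀ˢ {zero}  h = unitˢ
  ⋀ˢ {suc l} h = wedgeˢ (h zero) id (⋀ˢ (h ∘ suc))

  rowEntries : ∀ i (g : Fin l → Fin n) ps →
    map (λ (i , j) → A i j) (filter (λ (i , j) → P? i j)
      (map (i ,_) (tabulate g) ++ ps)) ≡
    i ⟨ g ⟩++ map (λ (i , j) → A i j) (filter (λ (i , j) → P? i j) ps)
  rowEntries {zero}  i g ps = refl
  rowEntries {suc l} i g ps with does (P? i (g zero))
  ... | true  = cong (A i (g zero) ∷_) (rowEntries i (g ∘ suc) ps)
  ... | false = rowEntries i (g ∘ suc) ps

  -- Transports the genericity hypothesis, stated for the row-by-row list of positions in the
  -- pattern, to the list of variables produced by the expansion.
  entries≡ : ∀ (h : Fin l → Fin m) →
    map (λ (i , j) → A i j) (filter (λ (i , j) → P? i j)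
      (cartesianProduct (tabulate h) (allFin n))) ≡ entries h
  entries≡ {zero}  h = refl
  entries≡ {suc l} h = trans (rowEntries (h zero) id _)
    (cong (h zero ⟨ id ⟩++_) (entries≡ (h ∘ suc)))

-- Sparse sets and the staircase pattern

-- The witness is the least element of `S`. The final segment starting there contains all of `S`, so
-- sparseness bounds its position.
sparse-first : (S : Subset k) → Sparse S → ∣ S ∣ ≡ suc m →
               ∃[ j ] (j ∈ S × toℕ j ℕ.+ 2 * suc m ℕ.≤ k ×
                       Sparse (S [ j ]≔ outside) × ∣ S [ j ]≔ outside ∣ ≡ m)
sparse-first {m = m} (inside ∷ S) (b , sp) refl =
  zero , here , b , (ℕₚ.≤-trans (ℕₚ.*-monoʳ-≤ 2 (ℕₚ.n≤1+n _)) b , sp) , refl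
sparse-first (outside ∷ S) (b , sp) eq with sparse-first S sp eq
... | j , j∈S , bound , sp′ , eq′ =
  suc j , there j∈S , s≤s bound ,
  (ℕₚ.≤-trans (ℕₚ.*-monoʳ-≤ 2 (ℕₚ.≤-trans (ℕₚ.≤-reflexive eq′)
     (ℕₚ.≤-trans (ℕₚ.n≤1+n _) (ℕₚ.≤-reflexive (sym eq))))) b , sp′) , eq′

staircase⁺ : ∀ {i : Fin m} {j : Fin n} → toℕ j ℕ.≤ 2 * toℕ i → Staircase i j
staircase⁺ {i = i} {j} j≤2i =
  subst (suc (toℕ j) ℕ.≤_) (sym (ℕₚ.+-suc (toℕ i) (toℕ i ℕ.+ 0))) (s≤s j≤2i)

staircase⁻ : ∀ {i : Fin m} {j : Fin n} → Staircase i j → toℕ j ℕ.≤ 2 * toℕ i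
staircase⁻ {i = i} {j} st =
  ℕ.s≤s⁻¹ (subst (suc (toℕ j) ℕ.≤_) (ℕₚ.+-suc (toℕ i) (toℕ i ℕ.+ 0)) st)

module _ (A : Matrix ℤ m (2 * m)) (A≡0 : ∀ i j → ¬ Staircase i j → A i j ≡ 0ℤ) where

  -- The first element of S is matched with the first row.
  ⋀ˢ-nontrivial : (h : Fin l → Fin m) → (∀ i → toℕ (h i) ℕ.+ l ≡ m ℕ.+ toℕ i) →
    ∀ S → Sparse S → ∣ S ∣ ≡ l → Nontrivial (⋀ˢ A staircase? A≡0 h S)
  ⋀ˢ-nontrivial {zero}  h last S sp eq = unitˢ-nontrivial A staircase? A≡0 S eq
  ⋀ˢ-nontrivial {suc l} h last S sp eq with sparse-first S sp eq
  ... | j , j∈S , bound , sp′ , eq′ =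
    wedgeˢ-nontrivial A staircase? A≡0 (h zero) id (⋀ˢ A staircase? A≡0 (h ∘ suc))
      j j∈S (staircase⁺ j≤2h)
      (⋀ˢ-nontrivial (h ∘ suc)
        (λ i → ℕₚ.suc-injective (trans (sym (ℕₚ.+-suc _ l))
          (trans (last (suc i)) (ℕₚ.+-suc m (toℕ i)))))
        (S [ j ]≔ outside) sp′ eq′)
    where
    -- By `last`, `h` lists the last `suc l` of the `m` rows, so `h zero` has index m - (l + 1). The
    -- bound on the least element of `S` is then exactly twice this index.
    j≤2h : toℕ j ℕ.≤ 2 * toℕ (h zero)
    j≤2h = ℕₚ.+-cancelʳ-≤ (2 * suc l) (toℕ j) (2 * toℕ (h zero))
      (ℕₚ.≤-trans bound (ℕₚ.≤-reflexive (trans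
        (cong (2 *_) (sym (trans (last zero) (ℕₚ.+-identityʳ m))))
        (ℕₚ.*-distribˡ-+ 2 (toℕ (h zero)) (suc l)))))

  sparse⇒linearlyIndependent : Generic (fromList (staircaseEntries A)) →
    ∀ S → Sparse S → ∣ S ∣ ≡ m → LinearlyIndependent (columns A) S
  sparse⇒linearlyIndependent generic S sp eq =
    free⇒linearlyIndependent (columns A) S (⋀≢0⇒free (columns A) S
      (generic⇒≢0 (⋀ˢ A staircase? A≡0 id S)
        (⋀ˢ-nontrivial id (λ i → ℕₚ.+-comm (toℕ i) m) S sp eq)
        (subst (Generic ∘ fromList) (entries≡ A staircase? A≡0 id) generic)))

-- Linearly independent sets of columns are sparse

free-tail : ∀ {x} {S : Subset k} (a : Vector (Vector ℚ m) (suc k)) →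
            Free ⊤ (x ∷ S) a → Free ⊤ S (a ∘ suc)
free-tail {k = k} a free c supp rel = free c′ supp′ rel′ ∘ suc
  where
  c′ : Vector ℚ (suc k)
  c′ zero    = 0ℚ
  c′ (suc j) = c j

  supp′ : Supported _ c′
  supp′ zero    _   = refl
  supp′ (suc j) j∉S = supp j (j∉S ∘ there)

  rel′ : ∀ i → i ∈ ⊤ → sum (λ j → c′ j ℚ.* a j i) ≡ 0ℚ
  rel′ i i∈⊤ = trans
    (cong (ℚ._+ sum (λ j → c j ℚ.* a (suc j) i)) (ℚₚ.*-zeroˡ (a zero i)))
    (trans (ℚₚ.+-identityˡ _) (rel i i∈⊤))

module _ {P : Fin k → Set} (P? : ∀ i → Dec (P i)) where

  ⟦_⟧ : Subset k
  ⟦_⟧ = Vec.tabulate (does ∘ P?)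

  ∈-⟦⟧⁺ : ∀ {i} → P i → i ∈ ⟦_⟧
  ∈-⟦⟧⁺ {i} p = Vecₚ.lookup⇒[]= i ⟦_⟧
    (trans (Vecₚ.lookup∘tabulate (does ∘ P?) i) (dec-true (P? i) p))

  ∈-⟦⟧⁻ : ∀ {i} → i ∈ ⟦_⟧ → P i
  ∈-⟦⟧⁻ {i} i∈
    with P? i | trans (sym (Vecₚ.lookup∘tabulate (does ∘ P?) i)) (Vecₚ.[]=⇒lookup i∈)
  ... | yes p | _ = p

-- If i is the least element of `R`, then `R` has at most m - i elements, and the hypothesis at i
-- says that twice this number is at most `l`.
final-bound : (R : Subset m) → (∀ {i} → i ∈ R → 2 * m ℕ.≤ 2 * toℕ i ℕ.+ l) →
              2 * ∣ R ∣ ℕ.≤ l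
final-bound []            final = z≤n
final-bound (inside ∷ R)  final = ℕₚ.≤-trans (ℕₚ.*-monoʳ-≤ 2 (s≤s (∣p∣≤n R))) (final here)
final-bound {m = suc m} {l} (outside ∷ R) final =
  final-bound R (λ {i} i∈R → ℕₚ.+-cancelˡ-≤ 2 _ _ (begin
    2 ℕ.+ 2 * m                  ≡⟨ ℕₚ.*-suc 2 m ⟨
    2 * suc m                    ≤⟨ final (there i∈R) ⟩
    2 * suc (toℕ i) ℕ.+ l        ≡⟨ cong (ℕ._+ l) (ℕₚ.*-suc 2 (toℕ i)) ⟩
    2 ℕ.+ (2 * toℕ i ℕ.+ l)      ∎))
  where open ℕₚ.≤-Reasoning

-- The zero pattern is stated relative to the number `l` of remaining columns: dropping the first
-- column lowers both `l` and the column index by one, so the inequality is preserved by the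
-- induction.
free⇒sparse : (S : Subset l) (a : Vector (Vector ℚ m) l) →
  (∀ i j → ¬ 2 * m ℕ.+ toℕ j ℕ.≤ 2 * toℕ i ℕ.+ l → a j i ≡ 0ℚ) →
  Free ⊤ S a → Sparse S
free⇒sparse [] a a≡0 free = _
free⇒sparse {suc l} {m} (x ∷ S) a a≡0 free =
  ℕₚ.≤-trans (ℕₚ.*-monoʳ-≤ 2 size) (final-bound R (∈-⟦⟧⁻ inR?)) ,
  free⇒sparse S (a ∘ suc)
    (λ i j ¬≤ → a≡0 i (suc j) (¬≤ ∘ λ ≤ → ℕ.s≤s⁻¹ (subst₂ ℕ._≤_
      (ℕₚ.+-suc (2 * m) (toℕ j)) (ℕₚ.+-suc (2 * toℕ i) l) ≤)))
    (free-tail a free)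
  where
  inR? : ∀ i → Dec (2 * m ℕ.≤ 2 * toℕ i ℕ.+ suc l)
  inR? i = 2 * m ℕₚ.≤? 2 * toℕ i ℕ.+ suc l

  R : Subset m
  R = ⟦_⟧ inR?

  a≡0′ : ∀ i → i ∉ R → ∀ j → a j i ≡ 0ℚ
  a≡0′ i i∉R j = a≡0 i j (i∉R ∘ ∈-⟦⟧⁺ inR? ∘ ℕₚ.≤-trans (ℕₚ.m≤m+n (2 * m) (toℕ j)))

  size : ∣ x ∷ S ∣ ℕ.≤ ∣ R ∣
  size with eliminate R (x ∷ S) a
  ... | inj₂ (_ , S≤R) = S≤R
  -- All columns vanish on rows outside `R`, so a relation on the rows in `R` holds on every row.
  ... | inj₁ (c , supp , nonzero , rel) =
    ⊥-elim (dependent⇒¬free {a = a} (c , supp , nonzero , λ i _ → rel′ i) free)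
    where
    rel′ : ∀ i → sum (λ j → c j ℚ.* a j i) ≡ 0ℚ
    rel′ = ∉-or-∈ R rel (λ i i∉R → sum-zero _ (λ j →
      trans (cong (c j ℚ.*_) (a≡0′ i i∉R j)) (ℚₚ.*-zeroʳ (c j))))

-- The isomorphism

image-id : (S : Subset k) → image idₚ S ≡ S
image-id = Vecₚ.tabulate∘lookup

theorem5p1 : (n : ℕ) → .{{_ : NonZero n}} → (A : Matrix ℤ n (2 * n)) →
    Generic (fromList (staircaseEntries A)) →
    (∀ i j → ¬ Staircase i j → A i j ≡ 0ℤ) →
    vectorMatroid (columns A) ≅ catalanMatroid n
theorem5p1 n A generic A≡0 = idₚ , λ S → mk⇔
  (λ ind → subst (CatalanIndependent n) (sym (image-id S)) (sparse⇒catalan n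
    (free⇒sparse S (columns A)
      -- For all `2 * n` columns the required zero pattern is the staircase condition j ≤ 2i with
      -- `2 * n` added on both sides.
      (λ i j ¬≤ → cong (ℚ._/ 1) (A≡0 i j (λ st → ¬≤ (subst (ℕ._≤ 2 * toℕ i ℕ.+ 2 * n)
        (ℕₚ.+-comm (toℕ j) (2 * n)) (ℕₚ.+-monoˡ-≤ (2 * n) (staircase⁻ st))))))
      (linearlyIndependent⇒free (columns A) S ind))))
  -- The minor argument needs a set of size `n`, so it is applied to an up-step set `B` containing
  -- `S`; independence then passes to the subset.
  (λ ind → let (B , isB , S⊆B) = subst (CatalanIndependent n) (image-id S) ind in
    Matroid.⊆-independent (vectorMatroid (columns A)) S⊆B
      (sparse⇒linearlyIndependent A A≡0 generic B
        (catalan⇒sparse n (B , isB , ⊆-refl)) (upStepSet-size n isB)))
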